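{- There exist a constant $c>0$ and an integer $n_0$ such that for every integer $n\ge n_0$ there is a choice of a set $\mathcal{O}$ of obstructing unit cubes in $[0,n]^3$ for which the number of cubes in $\mathcal{O}$ that are visible from the observer cube $[0,1]^3$ adjacent to the origin is at least $c\,n^{8/3}$.
   Context: The cube $[0,n]^3$ is partitioned into $n^3$ axis-aligned unit cubes $[a_1,a_1+1]\times[a_2,a_2+1]\times[a_3,a_3+1]$ with $a_i\in\{0,\dots,n-1\}$. The observer is the unit cube $[0,1]^3$. A configuration is a set $\mathcal{O}$ of unit cubes of this partition, different from the observer, that are declared obstructing; all other cubes are empty and lines of sight pass through them freely. An obstructing cube $Q\in\mathcal{O}$ is visible from the observer if there are a point $x$ of the observer cube and a point $y\in Q$ such that the line segment from $x$ to $y$ is unobstructed, i.e. it does not meet any obstructing cube $Q'\in\mathcal{O}$ with $Q'\neq Q$. -}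

module Defs where

open import Data.Nat.Base as ℕ using (ℕ; zero; suc)
import Data.Nat.Properties as ℕₚ
open import Data.Integer.Base as ℤ using (+_)
import Data.Integer.Properties as ℤₚ
open import Data.Rational.Base as ℚ using (ℚ; mkℚ; 0ℚ; 1ℚ; ½; toℚᵘ)
import Data.Rational.Properties as ℚₚ
import Data.Rational.Unnormalised.Base as ℚᵘ
import Data.Rational.Unnormalised.Properties as ℚᵘₚ
import Data.Rational.Solver as ℚSolver
import Data.Nat.Solver as ℕSolver
open import Data.Fin.Base using (Fin; toℕ)
open import Data.Vec.Base as Vec using (Vec; lookup; replicate)
open import Data.Product.Base using (∃; ∃-syntax; _×_; _,_; proj₁; proj₂)
open import Data.Sum.Base using (inj₁; inj₂)
open import Level using (0ℓ)
open import Relation.Nullary using (¬_; yes; no)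
open import Relation.Unary using (Pred; Decidable)
open import Relation.Binary.PropositionalEquality
  using (_≡_; _≢_; refl; sym; trans; cong; cong₂; subst; subst₂)

abs-bound : ∀ p {q} → p ℚ.≤ q → ℚ.- p ℚ.≤ q → ℚ.∣ p ∣ ℚ.≤ q
abs-bound p p≤q -p≤q with ℚₚ.∣p∣≡p∨∣p∣≡-p p
... | inj₁ eq = subst (ℚ._≤ _) (sym eq) p≤q
... | inj₂ eq = subst (ℚ._≤ _) (sym eq) -p≤q

*-mono-≤ : ∀ {p q r s} → 0ℚ ℚ.≤ q → 0ℚ ℚ.≤ r →
           p ℚ.≤ q → r ℚ.≤ s → p ℚ.* r ℚ.≤ q ℚ.* s
*-mono-≤ {p} {q} {r} {s} 0≤q 0≤r p≤q r≤s = ℚₚ.≤-trans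
  (ℚₚ.*-monoʳ-≤-nonNeg r {{ℚ.nonNegative 0≤r}} p≤q)
  (ℚₚ.*-monoˡ-≤-nonNeg q {{ℚ.nonNegative 0≤q}} r≤s)

p≤p+q : ∀ {p q} → 0ℚ ℚ.≤ q → p ℚ.≤ p ℚ.+ q
p≤p+q {p} {q} 0≤q =
  subst (ℚ._≤ p ℚ.+ q) (ℚₚ.+-identityʳ p) (ℚₚ.+-monoʳ-≤ p 0≤q)

half-pos : ∀ {ε} → 0ℚ ℚ.< ε → 0ℚ ℚ.< ε ℚ.* ½
half-pos {ε} 0<ε =
  subst (ℚ._< ε ℚ.* ½) (ℚₚ.*-zeroˡ ½) (ℚₚ.*-monoˡ-<-pos ½ 0<ε)

half+half : ∀ ε → ε ℚ.* ½ ℚ.+ ε ℚ.* ½ ≡ ε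
half+half ε = trans (sym (ℚₚ.*-distribˡ-+ ε ½ ½)) (ℚₚ.*-identityʳ ε)

divide : ∀ ε b → 0ℚ ℚ.< ε → 0ℚ ℚ.< b → ∃[ δ ] 0ℚ ℚ.< δ × δ ℚ.* b ≡ ε
divide ε b 0<ε 0<b = ε ℚ.* r , 0<εr ,
  trans (ℚₚ.*-assoc ε r b)
    (trans (cong (ε ℚ.*_) (ℚₚ.*-inverseˡ b)) (ℚₚ.*-identityʳ ε))
  where
  instance
    b⁺ = ℚ.positive 0<b
    b≢0 = ℚₚ.pos⇒nonZero b
  r = ℚ.1/ b
  0<εr : 0ℚ ℚ.< ε ℚ.* r
  0<εr = subst (ℚ._< ε ℚ.* r) (ℚₚ.*-zeroˡ r)
    (ℚₚ.*-monoˡ-<-pos r {{ℚₚ.1/pos⇒pos b}} 0<ε)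

*-close : ∀ {δ b c} p q r s → 0ℚ ℚ.≤ δ →
  ℚ.∣ p ℚ.- r ∣ ℚ.≤ δ → ℚ.∣ q ℚ.- s ∣ ℚ.≤ δ →
  ℚ.∣ p ∣ ℚ.≤ b → ℚ.∣ s ∣ ℚ.≤ c →
  ℚ.∣ p ℚ.* q ℚ.- r ℚ.* s ∣ ℚ.≤ δ ℚ.* (b ℚ.+ c)
*-close {δ} {b} {c} p q r s 0≤δ p≈r q≈s p≤b s≤c = begin
  ℚ.∣ p ℚ.* q ℚ.- r ℚ.* s ∣
    ≡⟨ cong ℚ.∣_∣ (rearrange p q r s) ⟩
  ℚ.∣ (q ℚ.- s) ℚ.* p ℚ.+ (p ℚ.- r) ℚ.* s ∣
    ≤⟨ ℚₚ.∣p+q∣≤∣p∣+∣q∣ ((q ℚ.- s) ℚ.* p) ((p ℚ.- r) ℚ.* s) ⟩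
  ℚ.∣ (q ℚ.- s) ℚ.* p ∣ ℚ.+ ℚ.∣ (p ℚ.- r) ℚ.* s ∣
    ≡⟨ cong₂ ℚ._+_ (ℚₚ.∣p*q∣≡∣p∣*∣q∣ (q ℚ.- s) p)
                   (ℚₚ.∣p*q∣≡∣p∣*∣q∣ (p ℚ.- r) s) ⟩
  ℚ.∣ q ℚ.- s ∣ ℚ.* ℚ.∣ p ∣ ℚ.+ ℚ.∣ p ℚ.- r ∣ ℚ.* ℚ.∣ s ∣
    ≤⟨ ℚₚ.+-mono-≤ (*-mono-≤ 0≤δ (ℚₚ.0≤∣p∣ p) q≈s p≤b)
                   (*-mono-≤ 0≤δ (ℚₚ.0≤∣p∣ s) p≈r s≤c) ⟩
  δ ℚ.* b ℚ.+ δ ℚ.* c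
    ≡⟨ ℚₚ.*-distribˡ-+ δ b c ⟨
  δ ℚ.* (b ℚ.+ c) ∎
  where
  open ℚₚ.≤-Reasoning
  rearrange : ∀ a b c d →
    a ℚ.* b ℚ.- c ℚ.* d ≡ (b ℚ.- d) ℚ.* a ℚ.+ (a ℚ.- c) ℚ.* d
  rearrange = solve 4 (λ a b c d →
    a :* b :- c :* d := (b :- d) :* a :+ (a :- c) :* d) refl
    where open ℚSolver.+-*-Solver

recip : ℕ → ℚ
recip m = + 1 ℚ./ suc m

/-mono-≤ : ∀ a b m n → a ℕ.* suc n ℕ.≤ b ℕ.* suc m →
           + a ℚ./ suc m ℚ.≤ + b ℚ./ suc n
/-mono-≤ a b m n le = ℚₚ.toℚᵘ-cancel-≤
  (ℚᵘₚ.≤-respˡ-≃ (ℚᵘₚ.≃-sym (ℚₚ.toℚᵘ-fromℚᵘ (ℚᵘ.mkℚᵘ (+ a) m)))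
  (ℚᵘₚ.≤-respʳ-≃ (ℚᵘₚ.≃-sym (ℚₚ.toℚᵘ-fromℚᵘ (ℚᵘ.mkℚᵘ (+ b) n)))
  (ℚᵘ.*≤* (subst₂ ℤ._≤_ (ℤₚ.pos-* a (suc n)) (ℤₚ.pos-* b (suc m)) (ℤ.+≤+ le)))))

/-suc : ∀ a m → + suc a ℚ./ suc m ≡ + a ℚ./ suc m ℚ.+ recip m
/-suc a m = ℚₚ.toℚᵘ-injective (begin
  toℚᵘ (+ suc a ℚ./ suc m)
    ≈⟨ ℚₚ.toℚᵘ-fromℚᵘ (ℚᵘ.mkℚᵘ (+ suc a) m) ⟩
  ℚᵘ.mkℚᵘ (+ suc a) m
    ≈⟨ ℚᵘ.*≡* (trans (sym (ℤₚ.pos-* (suc a) (suc m ℕ.* suc m)))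
         (trans (cong +_ (eq a (suc m))) (numerator a (suc m)))) ⟩
  ℚᵘ.mkℚᵘ (+ a) m ℚᵘ.+ ℚᵘ.mkℚᵘ (+ 1) m
    ≈⟨ ℚᵘₚ.+-cong (ℚₚ.toℚᵘ-fromℚᵘ (ℚᵘ.mkℚᵘ (+ a) m))
                  (ℚₚ.toℚᵘ-fromℚᵘ (ℚᵘ.mkℚᵘ (+ 1) m)) ⟨
  toℚᵘ (+ a ℚ./ suc m) ℚᵘ.+ toℚᵘ (recip m)
    ≈⟨ ℚₚ.toℚᵘ-homo-+ (+ a ℚ./ suc m) (recip m) ⟨
  toℚᵘ (+ a ℚ./ suc m ℚ.+ recip m) ∎)
  where
  open ℚᵘₚ.≃-Reasoning
  eq : ∀ a p → suc a ℕ.* (p ℕ.* p) ≡ (a ℕ.* p ℕ.+ 1 ℕ.* p) ℕ.* p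
  eq = solve 2 (λ a p →
    (con 1 :+ a) :* (p :* p) := (a :* p :+ con 1 :* p) :* p) refl
    where open ℕSolver.+-*-Solver
  numerator : ∀ a p → + ((a ℕ.* p ℕ.+ 1 ℕ.* p) ℕ.* p) ≡
              (+ a ℤ.* + p ℤ.+ + 1 ℤ.* + p) ℤ.* + p
  numerator a p = trans (ℤₚ.pos-* (a ℕ.* p ℕ.+ 1 ℕ.* p) p)
    (cong (ℤ._* + p) (trans (ℤₚ.pos-+ (a ℕ.* p) (1 ℕ.* p))
      (cong₂ ℤ._+_ (ℤₚ.pos-* a p) (ℤₚ.pos-* 1 p))))

archimedean : ∀ ε → 0ℚ ℚ.< ε → ∃[ N ] (∀ m → N ℕ.≤ m → recip m ℚ.≤ ε)
archimedean (mkℚ (ℤ.+[1+ k ]) d c) _ = d , λ m d≤m → ℚₚ.toℚᵘ-cancel-≤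
  (ℚᵘₚ.≤-respˡ-≃ (ℚᵘₚ.≃-sym (ℚₚ.toℚᵘ-fromℚᵘ (ℚᵘ.mkℚᵘ (+ 1) m)))
  (ℚᵘ.*≤* (subst₂ ℤ._≤_ (ℤₚ.pos-* 1 (suc d)) (ℤₚ.pos-* (suc k) (suc m))
    (ℤ.+≤+ (ℕₚ.*-mono-≤ {1} {suc k} (ℕ.s≤s ℕ.z≤n) (ℕ.s≤s d≤m))))))
archimedean (mkℚ (+ 0) d c) 0<ε with () ← ℚ.positive 0<ε
archimedean (mkℚ (ℤ.-[1+ k ]) d c) 0<ε with () ← ℚ.positive 0<ε

cube-* : ∀ a b → (a ℕ.* b) ℕ.^ 3 ≡ a ℕ.^ 3 ℕ.* b ℕ.^ 3
cube-* = solve 2 (λ a b → (a :* b) :^ 3 := a :^ 3 :* b :^ 3) refl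
  where open ℕSolver.+-*-Solver

cube-cancel-< : ∀ {a b} → a ℕ.^ 3 ℕ.< b ℕ.^ 3 → a ℕ.< b
cube-cancel-< a³<b³ =
  ℕₚ.≰⇒> λ b≤a → ℕₚ.<⇒≱ a³<b³ (ℕₚ.^-monoˡ-≤ 3 b≤a)

-- Real numbers as Cauchy sequences of rationals with a modulus of
-- convergence; equality of reals is _≃ᵣ_, not _≡_.

record ℝ : Set where
  constructor mkℝ
  field
    seq    : ℕ → ℚ
    cauchy : ∀ ε → 0ℚ ℚ.< ε →
             ∃[ N ] (∀ m n → N ℕ.≤ m → N ℕ.≤ n →
                     ℚ.∣ seq m ℚ.- seq n ∣ ℚ.≤ ε)

open ℝ public

infix  4 _≤ᵣ_ _<ᵣ_ _≃ᵣ_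
infixl 6 _+ᵣ_ _-ᵣ_
infixl 7 _*ᵣ_

_≤ᵣ_ : ℝ → ℝ → Set
x ≤ᵣ y = ∀ ε → 0ℚ ℚ.< ε →
         ∃[ N ] (∀ n → N ℕ.≤ n → seq x n ℚ.≤ seq y n ℚ.+ ε)

_<ᵣ_ : ℝ → ℝ → Set
x <ᵣ y = ∃[ ε ] 0ℚ ℚ.< ε ×
         ∃[ N ] (∀ n → N ℕ.≤ n → seq x n ℚ.+ ε ℚ.≤ seq y n)

_≃ᵣ_ : ℝ → ℝ → Set
x ≃ᵣ y = x ≤ᵣ y × y ≤ᵣ x

fromℚ : ℚ → ℝ
fromℚ q = mkℝ (λ _ → q) λ ε 0<ε → 0 , λ _ _ _ _ →
  subst (λ d → ℚ.∣ d ∣ ℚ.≤ ε) (sym (ℚₚ.+-inverseʳ q)) (ℚₚ.<⇒≤ 0<ε)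

fromℕ : ℕ → ℝ
fromℕ n = fromℚ (+ n ℚ./ 1)

0ᵣ 1ᵣ : ℝ
0ᵣ = fromℕ 0
1ᵣ = fromℕ 1

_+ᵣ_ : ℝ → ℝ → ℝ
seq (x +ᵣ y) n = seq x n ℚ.+ seq y n
cauchy (x +ᵣ y) ε 0<ε
  with M , cx ← cauchy x (ε ℚ.* ½) (half-pos 0<ε)
  with N , cy ← cauchy y (ε ℚ.* ½) (half-pos 0<ε)
  = M ℕ.⊔ N , λ m n m≥ n≥ → begin
    ℚ.∣ (seq x m ℚ.+ seq y m) ℚ.- (seq x n ℚ.+ seq y n) ∣
      ≡⟨ cong ℚ.∣_∣ (rearrange (seq x m) (seq y m) (seq x n) (seq y n)) ⟩
    ℚ.∣ (seq x m ℚ.- seq x n) ℚ.+ (seq y m ℚ.- seq y n) ∣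
      ≤⟨ ℚₚ.∣p+q∣≤∣p∣+∣q∣ (seq x m ℚ.- seq x n) (seq y m ℚ.- seq y n) ⟩
    ℚ.∣ seq x m ℚ.- seq x n ∣ ℚ.+ ℚ.∣ seq y m ℚ.- seq y n ∣
      ≤⟨ ℚₚ.+-mono-≤
           (cx m n (ℕₚ.m⊔n≤o⇒m≤o M N m≥) (ℕₚ.m⊔n≤o⇒m≤o M N n≥))
           (cy m n (ℕₚ.m⊔n≤o⇒n≤o M N m≥) (ℕₚ.m⊔n≤o⇒n≤o M N n≥)) ⟩
    ε ℚ.* ½ ℚ.+ ε ℚ.* ½
      ≡⟨ half+half ε ⟩
    ε ∎
  where
  open ℚₚ.≤-Reasoning
  rearrange : ∀ a b c d → (a ℚ.+ b) ℚ.- (c ℚ.+ d) ≡ (a ℚ.- c) ℚ.+ (b ℚ.- d)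
  rearrange = solve 4 (λ a b c d →
    (a :+ b) :- (c :+ d) := (a :- c) :+ (b :- d)) refl
    where open ℚSolver.+-*-Solver

-ᵣ_ : ℝ → ℝ
seq (-ᵣ x) n = ℚ.- seq x n
cauchy (-ᵣ x) ε 0<ε with N , cx ← cauchy x ε 0<ε
  = N , λ m n m≥ n≥ → subst (ℚ._≤ ε)
      (trans (sym (ℚₚ.∣-p∣≡∣p∣ (seq x m ℚ.- seq x n)))
             (cong ℚ.∣_∣ (ℚₚ.neg-distrib-+ (seq x m) (ℚ.- seq x n))))
      (cx m n m≥ n≥)

_-ᵣ_ : ℝ → ℝ → ℝ
x -ᵣ y = x +ᵣ (-ᵣ y)

eventually-bounded : ∀ x → ∃[ b ] 0ℚ ℚ.< b ×
  ∃[ N ] (∀ n → N ℕ.≤ n → ℚ.∣ seq x n ∣ ℚ.≤ b)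
eventually-bounded x with N , cx ← cauchy x 1ℚ (ℚₚ.positive⁻¹ 1ℚ)
  = ℚ.∣ seq x N ∣ ℚ.+ 1ℚ ,
    ℚₚ.+-mono-≤-< (ℚₚ.0≤∣p∣ (seq x N)) (ℚₚ.positive⁻¹ 1ℚ) ,
    N , λ n n≥ → begin
      ℚ.∣ seq x n ∣
        ≡⟨ cong ℚ.∣_∣ (split (seq x n) (seq x N)) ⟩
      ℚ.∣ seq x N ℚ.+ (seq x n ℚ.- seq x N) ∣
        ≤⟨ ℚₚ.∣p+q∣≤∣p∣+∣q∣ (seq x N) (seq x n ℚ.- seq x N) ⟩
      ℚ.∣ seq x N ∣ ℚ.+ ℚ.∣ seq x n ℚ.- seq x N ∣
        ≤⟨ ℚₚ.+-monoʳ-≤ ℚ.∣ seq x N ∣ (cx n N n≥ ℕₚ.≤-refl) ⟩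
      ℚ.∣ seq x N ∣ ℚ.+ 1ℚ ∎
  where
  open ℚₚ.≤-Reasoning
  split : ∀ a b → a ≡ b ℚ.+ (a ℚ.- b)
  split = solve 2 (λ a b → a := b :+ (a :- b)) refl
    where open ℚSolver.+-*-Solver

_*ᵣ_ : ℝ → ℝ → ℝ
seq (x *ᵣ y) n = seq x n ℚ.* seq y n
cauchy (x *ᵣ y) ε 0<ε =
  let b , 0<b , M , bx = eventually-bounded x
      c , 0<c , N , cy = eventually-bounded y
      δ , 0<δ , δbc≡ε  = divide ε (b ℚ.+ c) 0<ε (ℚₚ.+-mono-< 0<b 0<c)
      K , dx           = cauchy x δ 0<δ
      L , dy           = cauchy y δ 0<δ
      MN               = M ℕ.⊔ N
      KL               = K ℕ.⊔ L
  in MN ℕ.⊔ KL , λ m n m≥ n≥ →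
    let m≥MN = ℕₚ.m⊔n≤o⇒m≤o MN KL m≥
        n≥MN = ℕₚ.m⊔n≤o⇒m≤o MN KL n≥
        m≥KL = ℕₚ.m⊔n≤o⇒n≤o MN KL m≥
        n≥KL = ℕₚ.m⊔n≤o⇒n≤o MN KL n≥
    in subst (ℚ.∣ seq x m ℚ.* seq y m ℚ.- seq x n ℚ.* seq y n ∣ ℚ.≤_) δbc≡ε
      (*-close (seq x m) (seq y m) (seq x n) (seq y n) (ℚₚ.<⇒≤ 0<δ)
        (dx m n (ℕₚ.m⊔n≤o⇒m≤o K L m≥KL) (ℕₚ.m⊔n≤o⇒m≤o K L n≥KL))
        (dy m n (ℕₚ.m⊔n≤o⇒n≤o K L m≥KL) (ℕₚ.m⊔n≤o⇒n≤o K L n≥KL))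
        (bx m (ℕₚ.m⊔n≤o⇒m≤o M N m≥MN))
        (cy n (ℕₚ.m⊔n≤o⇒n≤o M N n≥MN)))

floor-cbrt : ∀ k → ∃[ a ] (a ℕ.^ 3 ℕ.≤ k) × (k ℕ.< suc a ℕ.^ 3)
floor-cbrt zero = 0 , ℕ.z≤n , ℕ.s≤s ℕ.z≤n
floor-cbrt (suc k) with a , a³≤k , k<[1+a]³ ← floor-cbrt k
  with suc a ℕ.^ 3 ℕₚ.≤? suc k
... | yes [1+a]³≤1+k = suc a , [1+a]³≤1+k ,
      ℕₚ.≤-<-trans k<[1+a]³ (ℕₚ.^-monoˡ-< 3 (ℕₚ.n<1+n (suc a)))
... | no  [1+a]³≰1+k = a , ℕₚ.m≤n⇒m≤1+n a³≤k , ℕₚ.≰⇒> [1+a]³≰1+k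

-- ⌊ (m + 1) ∛k ⌋
cbrt-num : ℕ → ℕ → ℕ
cbrt-num k m = proj₁ (floor-cbrt (k ℕ.* suc m ℕ.^ 3))

cbrt-seq : ℕ → ℕ → ℚ
cbrt-seq k m = + cbrt-num k m ℚ./ suc m

cbrt-seq-close : ∀ k m n → cbrt-seq k m ℚ.≤ cbrt-seq k n ℚ.+ recip n
cbrt-seq-close k m n = subst (cbrt-seq k m ℚ.≤_) (/-suc b n)
  (/-mono-≤ a (suc b) m n (ℕₚ.<⇒≤ (cube-cancel-< (begin-strict
    (a ℕ.* suc n) ℕ.^ 3                ≡⟨ cube-* a (suc n) ⟩
    a ℕ.^ 3 ℕ.* suc n ℕ.^ 3            ≤⟨ ℕₚ.*-monoˡ-≤ (suc n ℕ.^ 3) a³≤ ⟩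
    k ℕ.* suc m ℕ.^ 3 ℕ.* suc n ℕ.^ 3  ≡⟨ swap k (suc m ℕ.^ 3) (suc n ℕ.^ 3) ⟩
    k ℕ.* suc n ℕ.^ 3 ℕ.* suc m ℕ.^ 3  <⟨ ℕₚ.*-monoˡ-< (suc m ℕ.^ 3) {{ℕₚ.m^n≢0 (suc m) 3}} <b³ ⟩
    suc b ℕ.^ 3 ℕ.* suc m ℕ.^ 3        ≡⟨ cube-* (suc b) (suc m) ⟨
    (suc b ℕ.* suc m) ℕ.^ 3            ∎))))
  where
  open ℕₚ.≤-Reasoning
  a = cbrt-num k m
  b = cbrt-num k n
  a³≤ = proj₁ (proj₂ (floor-cbrt (k ℕ.* suc m ℕ.^ 3)))
  <b³ = proj₂ (proj₂ (floor-cbrt (k ℕ.* suc n ℕ.^ 3)))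
  swap : ∀ p q r → p ℕ.* q ℕ.* r ≡ p ℕ.* r ℕ.* q
  swap p q r = trans (ℕₚ.*-assoc p q r)
    (trans (cong (p ℕ.*_) (ℕₚ.*-comm q r)) (sym (ℕₚ.*-assoc p r q)))

-- ∛k, by rational approximations from below; n^{8/3} is cbrt (n ^ 8).
-- 0≤cbrt and cbrt-cubed characterise it as the real cube root.
cbrt : ℕ → ℝ
seq (cbrt k) = cbrt-seq k
cauchy (cbrt k) ε 0<ε with N , small ← archimedean ε 0<ε
  = N , λ m n m≥ n≥ →
    abs-bound (u m ℚ.- u n)
      (one-sided (u m) (u n) (cbrt-seq-close k m n) (small n n≥))
      (subst (ℚ._≤ ε) (flip (u m) (u n))
        (one-sided (u n) (u m) (cbrt-seq-close k n m) (small m m≥)))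
  where
  u = cbrt-seq k
  cancel : ∀ p q → (q ℚ.+ p) ℚ.- q ≡ p
  cancel = solve 2 (λ p q → (q :+ p) :- q := p) refl
    where open ℚSolver.+-*-Solver
  flip : ∀ p q → q ℚ.- p ≡ ℚ.- (p ℚ.- q)
  flip = solve 2 (λ p q → q :- p := :- (p :- q)) refl
    where open ℚSolver.+-*-Solver
  one-sided : ∀ p q {r} → p ℚ.≤ q ℚ.+ r → r ℚ.≤ ε → p ℚ.- q ℚ.≤ ε
  one-sided p q {r} p≤q+r r≤ε = ℚₚ.≤-trans
    (subst (p ℚ.- q ℚ.≤_) (cancel r q) (ℚₚ.+-monoˡ-≤ (ℚ.- q) p≤q+r)) r≤ε

/-cube : ∀ a m → toℚᵘ ((+ a ℚ./ suc m) ℚ.* (+ a ℚ./ suc m) ℚ.* (+ a ℚ./ suc m))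
         ℚᵘ.≃ ℚᵘ.mkℚᵘ (+ a) m ℚᵘ.* ℚᵘ.mkℚᵘ (+ a) m ℚᵘ.* ℚᵘ.mkℚᵘ (+ a) m
/-cube a m = ℚᵘₚ.≃-trans (ℚₚ.toℚᵘ-homo-* (q ℚ.* q) q)
  (ℚᵘₚ.*-cong (ℚᵘₚ.≃-trans (ℚₚ.toℚᵘ-homo-* q q) (ℚᵘₚ.*-cong q≃ q≃)) q≃)
  where
  q = + a ℚ./ suc m
  q≃ = ℚₚ.toℚᵘ-fromℚᵘ (ℚᵘ.mkℚᵘ (+ a) m)

pos-cube : ∀ a → + a ℤ.* + a ℤ.* + a ≡ + (a ℕ.^ 3)
pos-cube a = trans (cong (ℤ._* + a) (sym (ℤₚ.pos-* a a)))
  (trans (sym (ℤₚ.pos-* (a ℕ.* a) a)) (cong +_ (eq a)))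
  where
  open ℕSolver.+-*-Solver
  eq : ∀ a → a ℕ.* a ℕ.* a ≡ a ℕ.^ 3
  eq = solve 1 (λ a → a :* a :* a := a :^ 3) refl

cube-pos : ∀ p → p ℕ.^ 3 ≡ p ℕ.* p ℕ.* p
cube-pos = solve 1 (λ a → a :^ 3 := a :* a :* a) refl
  where open ℕSolver.+-*-Solver

/-cube-≤ : ∀ a k m → a ℕ.^ 3 ℕ.≤ k ℕ.* suc m ℕ.^ 3 →
  (+ a ℚ./ suc m) ℚ.* (+ a ℚ./ suc m) ℚ.* (+ a ℚ./ suc m) ℚ.≤ + k ℚ./ 1
/-cube-≤ a k m a³≤ = ℚₚ.toℚᵘ-cancel-≤
  (ℚᵘₚ.≤-respˡ-≃ (ℚᵘₚ.≃-sym (/-cube a m))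
  (ℚᵘₚ.≤-respʳ-≃ (ℚᵘₚ.≃-sym (ℚₚ.toℚᵘ-fromℚᵘ (ℚᵘ.mkℚᵘ (+ k) 0)))
  (ℚᵘ.*≤* (subst₂ ℤ._≤_
    (sym (trans (ℤₚ.*-identityʳ _) (pos-cube a)))
    (trans (cong (λ z → + (k ℕ.* z)) (cube-pos (suc m))) (ℤₚ.pos-* k _))
    (ℤ.+≤+ a³≤)))))

≤-/-cube : ∀ a k m → k ℕ.* suc m ℕ.^ 3 ℕ.≤ a ℕ.^ 3 →
  + k ℚ./ 1 ℚ.≤ (+ a ℚ./ suc m) ℚ.* (+ a ℚ./ suc m) ℚ.* (+ a ℚ./ suc m)
≤-/-cube a k m ≤a³ = ℚₚ.toℚᵘ-cancel-≤
  (ℚᵘₚ.≤-respʳ-≃ (ℚᵘₚ.≃-sym (/-cube a m))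
  (ℚᵘₚ.≤-respˡ-≃ (ℚᵘₚ.≃-sym (ℚₚ.toℚᵘ-fromℚᵘ (ℚᵘ.mkℚᵘ (+ k) 0)))
  (ℚᵘ.*≤* (subst₂ ℤ._≤_
    (trans (cong (λ z → + (k ℕ.* z)) (cube-pos (suc m))) (ℤₚ.pos-* k _))
    (sym (trans (ℤₚ.*-identityʳ _) (pos-cube a)))
    (ℤ.+≤+ ≤a³)))))

0≤/ : ∀ a m → 0ℚ ℚ.≤ + a ℚ./ suc m
0≤/ a m = /-mono-≤ 0 a 0 m ℕ.z≤n

cbrt-seq-≤ : ∀ k m → cbrt-seq k m ℚ.≤ + k ℚ./ 1
cbrt-seq-≤ k m = /-mono-≤ a k m 0 (subst (ℕ._≤ k ℕ.* suc m)
  (sym (ℕₚ.*-identityʳ a)) (ℕₚ.≮⇒≥ λ kp<a → ℕₚ.<⇒≱ (ℕₚ.^-monoˡ-< 3 kp<a)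
    (ℕₚ.≤-trans a³≤ (subst (k ℕ.* suc m ℕ.^ 3 ℕ.≤_) (sym (cube-* k (suc m)))
      (ℕₚ.*-monoˡ-≤ (suc m ℕ.^ 3) (k≤k³ k))))))
  where
  a = cbrt-num k m
  a³≤ = proj₁ (proj₂ (floor-cbrt (k ℕ.* suc m ℕ.^ 3)))
  k≤k³ : ∀ k → k ℕ.≤ k ℕ.^ 3
  k≤k³ zero = ℕ.z≤n
  k≤k³ (suc k) = ℕₚ.m≤m*n (suc k) (suc k ℕ.^ 2) {{ℕₚ.m^n≢0 (suc k) 2}}

cube-+-≤ : ∀ {u δ l} → 0ℚ ℚ.≤ u → 0ℚ ℚ.≤ δ → u ℚ.+ δ ℚ.≤ l →
  (u ℚ.+ δ) ℚ.* (u ℚ.+ δ) ℚ.* (u ℚ.+ δ) ℚ.≤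
  u ℚ.* u ℚ.* u ℚ.+ δ ℚ.* (l ℚ.* l ℚ.+ l ℚ.* l ℚ.+ l ℚ.* l)
cube-+-≤ {u} {δ} {l} 0≤u 0≤δ w≤l = subst
  (ℚ._≤ u ℚ.* u ℚ.* u ℚ.+ δ ℚ.* (l ℚ.* l ℚ.+ l ℚ.* l ℚ.+ l ℚ.* l))
  (sym (expand u δ))
  (ℚₚ.+-monoʳ-≤ (u ℚ.* u ℚ.* u)
    (ℚₚ.*-monoˡ-≤-nonNeg δ {{ℚ.nonNegative 0≤δ}}
      (ℚₚ.+-mono-≤ (ℚₚ.+-mono-≤
        (*-mono-≤ 0≤l 0≤w w≤l w≤l) (*-mono-≤ 0≤l 0≤u w≤l u≤l))
        (*-mono-≤ 0≤l 0≤u u≤l u≤l))))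
  where
  u≤w = p≤p+q {u} 0≤δ
  0≤w = ℚₚ.≤-trans 0≤u u≤w
  0≤l = ℚₚ.≤-trans 0≤w w≤l
  u≤l = ℚₚ.≤-trans u≤w w≤l
  open ℚSolver.+-*-Solver
  expand : ∀ u δ → (u ℚ.+ δ) ℚ.* (u ℚ.+ δ) ℚ.* (u ℚ.+ δ) ≡
    u ℚ.* u ℚ.* u ℚ.+
    δ ℚ.* ((u ℚ.+ δ) ℚ.* (u ℚ.+ δ) ℚ.+ (u ℚ.+ δ) ℚ.* u ℚ.+ u ℚ.* u)
  expand = solve 2 (λ u δ → (u :+ δ) :* (u :+ δ) :* (u :+ δ) :=
    u :* u :* u :+
    δ :* ((u :+ δ) :* (u :+ δ) :+ (u :+ δ) :* u :+ u :* u)) refl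

0≤cbrt : ∀ k → 0ᵣ ≤ᵣ cbrt k
0≤cbrt k ε 0<ε = 0 , λ m _ →
  ℚₚ.≤-trans (0≤/ (cbrt-num k m) m) (p≤p+q (ℚₚ.<⇒≤ 0<ε))

cbrt-cubed : ∀ k → cbrt k *ᵣ cbrt k *ᵣ cbrt k ≃ᵣ fromℕ k
cbrt-cubed k = below , above
  where
  below : cbrt k *ᵣ cbrt k *ᵣ cbrt k ≤ᵣ fromℕ k
  below ε 0<ε = 0 , λ m _ → ℚₚ.≤-trans
    (/-cube-≤ (cbrt-num k m) k m
      (proj₁ (proj₂ (floor-cbrt (k ℕ.* suc m ℕ.^ 3)))))
    (p≤p+q (ℚₚ.<⇒≤ 0<ε))
  l = + k ℚ./ 1 ℚ.+ 1ℚ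
  0<1 = ℚₚ.positive⁻¹ 1ℚ
  0<l : 0ℚ ℚ.< l
  0<l = ℚₚ.+-mono-≤-< (0≤/ k 0) 0<1
  0<l² : 0ℚ ℚ.< l ℚ.* l
  0<l² = subst (ℚ._< l ℚ.* l) (ℚₚ.*-zeroˡ l)
    (ℚₚ.*-monoˡ-<-pos l {{ℚ.positive 0<l}} 0<l)
  b = l ℚ.* l ℚ.+ l ℚ.* l ℚ.+ l ℚ.* l
  0<b : 0ℚ ℚ.< b
  0<b = ℚₚ.+-mono-< (ℚₚ.+-mono-< 0<l² 0<l²) 0<l²
  above : fromℕ k ≤ᵣ cbrt k *ᵣ cbrt k *ᵣ cbrt k
  above ε 0<ε =
    let δ , 0<δ , δb≡ε = divide ε b 0<ε 0<b
        N , small = archimedean δ 0<δ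
    in N , λ m m≥ →
      let u = cbrt-seq k m
          r = recip m
          a = cbrt-num k m
      in ℚₚ.≤-trans
        (subst (λ w → + k ℚ./ 1 ℚ.≤ w ℚ.* w ℚ.* w) (/-suc a m)
          (≤-/-cube (suc a) k m
            (ℕₚ.<⇒≤ (proj₂ (proj₂ (floor-cbrt (k ℕ.* suc m ℕ.^ 3)))))))
        (ℚₚ.≤-trans
          (cube-+-≤ {u} {r} {l} (0≤/ a m) (0≤/ 1 m)
            (ℚₚ.+-mono-≤ (cbrt-seq-≤ k m) (recip≤1 m)))
          (ℚₚ.+-monoʳ-≤ (u ℚ.* u ℚ.* u)
            (subst (r ℚ.* b ℚ.≤_) δb≡ε
              (ℚₚ.*-monoʳ-≤-nonNeg b
                {{ℚ.nonNegative (ℚₚ.<⇒≤ 0<b)}} (small m m≥)))))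
    where
    recip≤1 : ∀ m → recip m ℚ.≤ 1ℚ
    recip≤1 m = /-mono-≤ 1 1 m 0 (ℕ.s≤s ℕ.z≤n)

Point : Set
Point = Fin 3 → ℝ

-- The closed unit cube whose least corner is a.
infix 4 _∈□_
_∈□_ : Point → Vec ℕ 3 → Set
x ∈□ a = ∀ i → (fromℕ (lookup a i) ≤ᵣ x i) × (x i ≤ᵣ fromℕ (suc (lookup a i)))

segment : Point → Point → ℝ → Point
segment x y t i = (1ᵣ -ᵣ t) *ᵣ x i +ᵣ t *ᵣ y i

SegmentMeets : Point → Point → Vec ℕ 3 → Set
SegmentMeets x y a =
  ∃[ t ] (0ᵣ ≤ᵣ t) × (t ≤ᵣ 1ᵣ) × (segment x y t ∈□ a)

Cube : ℕ → Set
Cube n = Vec (Fin n) 3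

corner : ∀ {n} → Cube n → Vec ℕ 3
corner = Vec.map toℕ

observer : Vec ℕ 3
observer = replicate 3 0

-- Decidability of Obstructing makes it a genuine finite set of cubes
-- constructively; classically every set of cubes qualifies.
record Configuration (n : ℕ) : Set₁ where
  field
    Obstructing    : Pred (Cube n) 0ℓ
    obstructing?   : Decidable Obstructing
    observer-empty : ∀ Q → Obstructing Q → corner Q ≢ observer

open Configuration public

Visible : ∀ {n} → Configuration n → Cube n → Set
Visible O Q = Obstructing O Q ×
  ∃[ x ] ∃[ y ] (x ∈□ observer) × (y ∈□ corner Q) ×
    (∀ Q′ → Obstructing O Q′ → Q′ ≢ Q → ¬ SegmentMeets x y (corner Q′))

{-# OPTIONS --safe #-}

-- Project from the observer and cut the directions into about n² cells of
-- width 1/n, L = m³ ~ n.  Inside a cell of direction (1, i/L, j/L) there is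
-- one lattice point per depth k.  Dirichlet's theorem gives a small integer
-- vector N = (p, q, r), with |q|, |r| ≤ m, almost orthogonal to the direction,
-- so that N takes only O(m) values on the points of the cell and some level
-- N · X = c > 0 contains at least of order m² ~ n^{2/3} of them.  Cubes on one
-- level do not hide each other: let e be the vertex of [0,1]³ minimising N,
-- and look at the cube X along the segment e + t X.  If it meets the cube X′
-- then t X − X′ + e ∈ [0,1]³, hence (t − 1) c = N · (t X − X′) ≥ 0 and t = 1.
-- Cubes of different cells do not hide each other because their directions
-- are too far apart.
module Submission where

open import Defs
open import Data.Bool.Base using (true; false)
open import Data.Fin.Base as Fin using (Fin; zero; suc; toℕ)
open import Data.Fin.Patterns using (0F; 1F; 2F)
import Data.Fin.Properties as Finₚ
open import Data.Integer.Base as ℤ using (ℤ; +_; -[1+_]; +[1+_])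
import Data.Integer.Properties as ℤₚ
import Data.Integer.Tactic.RingSolver as ℤR
open import Data.List.Base
  using (List; []; _∷_; length; filter; concatMap; map; allFin)
open import Data.List.Membership.Propositional using (_∈_)
import Data.List.Membership.DecPropositional as DecMembership
import Data.List.Membership.Propositional.Properties as ∈ₚ
import Data.List.Properties as Listₚ
open import Data.List.Relation.Unary.All as All using (All)
import Data.List.Relation.Unary.All.Properties as Allₚ
open import Data.List.Relation.Unary.AllPairs using ([]; _∷_)
open import Data.List.Relation.Unary.Any using (here; there)
open import Data.List.Relation.Unary.Unique.Propositional using (Unique)
import Data.List.Relation.Unary.Unique.Propositional.Properties as Uniqueₚ
open import Data.Nat.Base as ℕ
  using (ℕ; zero; suc; _≤_; _^_; s≤s; z≤n; NonZero)
import Data.Nat.DivMod as ℕD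
import Data.Nat.Properties as ℕₚ
import Data.Nat.Tactic.RingSolver as ℕR
open import Data.Product.Base as Product using (∃-syntax; _×_; _,_; proj₁; proj₂)
open import Data.Product.Properties using (,-injectiveʳ)
open import Data.Rational.Base as ℚ using (ℚ; mkℚ; 0ℚ; toℚᵘ)
import Data.Rational.Properties as ℚₚ
import Data.Rational.Unnormalised.Base as ℚᵘ
import Data.Rational.Unnormalised.Properties as ℚᵘₚ
open import Data.Sum.Base using (_⊎_; inj₁; inj₂)
open import Data.Vec.Base using (Vec; lookup; tabulate)
import Data.Vec.Properties as Vecₚ
open import Level using (0ℓ)
open import Relation.Binary.PropositionalEquality
open import Relation.Nullary using (¬_; does; yes; no; contradiction)
open import Relation.Unary using (Pred; Decidable)

-- Transfer of rational inequalities to integer fractions.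

infix 4 _≃ᵘ_
-- Arithmetic in `ℚᵘ` does not reduce fractions, so an inequality moved there unfolds to a
-- polynomial inequality between integers.
_≃ᵘ_ : ℚ → ℚᵘ.ℚᵘ → Set
p ≃ᵘ P = toℚᵘ p ℚᵘ.≃ P

/-≃ᵘ : ∀ z d → (z ℚ./ suc d) ≃ᵘ ℚᵘ.mkℚᵘ z d
/-≃ᵘ z d = ℚₚ.toℚᵘ-fromℚᵘ (ℚᵘ.mkℚᵘ z d)

+-≃ᵘ : ∀ p q {P Q} → p ≃ᵘ P → q ≃ᵘ Q → p ℚ.+ q ≃ᵘ P ℚᵘ.+ Q
+-≃ᵘ p q p≃ q≃ = ℚᵘₚ.≃-trans (ℚₚ.toℚᵘ-homo-+ p q) (ℚᵘₚ.+-cong p≃ q≃)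

*-≃ᵘ : ∀ p q {P Q} → p ≃ᵘ P → q ≃ᵘ Q → p ℚ.* q ≃ᵘ P ℚᵘ.* Q
*-≃ᵘ p q p≃ q≃ = ℚᵘₚ.≃-trans (ℚₚ.toℚᵘ-homo-* p q) (ℚᵘₚ.*-cong p≃ q≃)

neg-≃ᵘ : ∀ p {P} → p ≃ᵘ P → ℚ.- p ≃ᵘ ℚᵘ.- P
neg-≃ᵘ p p≃ = ℚᵘₚ.≃-trans (ℚₚ.toℚᵘ-homo‿- p) (ℚᵘₚ.-‿cong p≃)

≤-≃ᵘ : ∀ {p q P Q} → p ≃ᵘ P → q ≃ᵘ Q → p ℚ.≤ q → P ℚᵘ.≤ Q
≤-≃ᵘ p≃ q≃ p≤q =
  ℚᵘₚ.≤-respˡ-≃ p≃ (ℚᵘₚ.≤-respʳ-≃ q≃ (ℚₚ.toℚᵘ-mono-≤ p≤q))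

≃ᵘ-≤ : ∀ {p q P Q} → p ≃ᵘ P → q ≃ᵘ Q → P ℚᵘ.≤ Q → p ℚ.≤ q
≃ᵘ-≤ p≃ q≃ P≤Q = ℚₚ.toℚᵘ-cancel-≤
  (ℚᵘₚ.≤-respˡ-≃ (ℚᵘₚ.≃-sym p≃) (ℚᵘₚ.≤-respʳ-≃ (ℚᵘₚ.≃-sym q≃) P≤Q))

-- Elementary real bounds and the comparison of cube roots with integers.

recip-pos : ∀ m → 0ℚ ℚ.< recip m
recip-pos m = ℚₚ.positive⁻¹ (recip m) {{ℚₚ.normalize-pos 1 (suc m)}}

fromℕ-mono-≤ : ∀ a b → a ≤ b → fromℕ a ≤ᵣ fromℕ b
fromℕ-mono-≤ a b a≤b ε 0<ε = 0 , λ _ _ → ℚₚ.≤-trans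
  (/-mono-≤ a b 0 0 (ℕₚ.*-monoˡ-≤ 1 a≤b)) (p≤p+q (ℚₚ.<⇒≤ 0<ε))

-- The numerator a of the approximation satisfies a³ ≤ k (j + 1)³ ≤ (u (j + 1))³. Thus `u` replaces
-- the root at every index, and the bound survives without any error term.
recip-*-cbrt-seq-≤ : ∀ C k l u j → k ≤ u ^ 3 → u ≤ l ℕ.* suc C →
  recip C ℚ.* cbrt-seq k j ℚ.≤ + l ℚ./ 1
recip-*-cbrt-seq-≤ C k l u j k≤u³ u≤lC = ≃ᵘ-≤
  (*-≃ᵘ (recip C) (+ a ℚ./ suc j) (/-≃ᵘ (+ 1) C) (/-≃ᵘ (+ a) j))
  (/-≃ᵘ (+ l) 0)
  (ℚᵘ.*≤* (subst₂ ℤ._≤_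
    (sym (trans (ℤₚ.*-identityʳ _) (ℤₚ.*-identityˡ (+ a))))
    (ℤₚ.pos-* l (suc C ℕ.* suc j)) (ℤ.+≤+ a≤)))
  where
  a = cbrt-num k j
  a≤uj : a ≤ u ℕ.* suc j
  a≤uj = ℕₚ.≮⇒≥ λ uj<a → ℕₚ.<⇒≱ (ℕₚ.^-monoˡ-< 3 uj<a) (begin
    a ^ 3                ≤⟨ proj₁ (proj₂ (floor-cbrt (k ℕ.* suc j ^ 3))) ⟩
    k ℕ.* suc j ^ 3      ≤⟨ ℕₚ.*-monoˡ-≤ (suc j ^ 3) k≤u³ ⟩
    u ^ 3 ℕ.* suc j ^ 3  ≡⟨ cube-* u (suc j) ⟨
    (u ℕ.* suc j) ^ 3    ∎)
    where open ℕₚ.≤-Reasoning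
  a≤ : a ≤ l ℕ.* (suc C ℕ.* suc j)
  a≤ = begin
    a                        ≤⟨ a≤uj ⟩
    u ℕ.* suc j              ≤⟨ ℕₚ.*-monoˡ-≤ (suc j) u≤lC ⟩
    l ℕ.* suc C ℕ.* suc j    ≡⟨ ℕₚ.*-assoc l (suc C) (suc j) ⟩
    l ℕ.* (suc C ℕ.* suc j)  ∎
    where open ℕₚ.≤-Reasoning

recip-*ᵣ-cbrt-≤ : ∀ C k l u → k ≤ u ^ 3 → u ≤ l ℕ.* suc C →
  fromℚ (recip C) *ᵣ cbrt k ≤ᵣ fromℕ l
recip-*ᵣ-cbrt-≤ C k l u k≤u³ u≤lC ε 0<ε = 0 , λ j _ → ℚₚ.≤-trans
  (recip-*-cbrt-seq-≤ C k l u j k≤u³ u≤lC) (p≤p+q (ℚₚ.<⇒≤ 0<ε))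

-- From a real segment meeting a cube to integer inequalities.

interp : ℚ → ℤ → ℤ → ℚ
interp t b c = (+ 1 ℚ./ 1 ℚ.+ ℚ.- t) ℚ.* (b ℚ./ 1) ℚ.+ t ℚ.* (c ℚ./ 1)

interpᵘ : ℚᵘ.ℚᵘ → ℤ → ℤ → ℚᵘ.ℚᵘ
interpᵘ t b c = (ℚᵘ.mkℚᵘ (+ 1) 0 ℚᵘ.+ ℚᵘ.- t) ℚᵘ.* ℚᵘ.mkℚᵘ b 0 ℚᵘ.+ t ℚᵘ.* ℚᵘ.mkℚᵘ c 0

interp-≃ᵘ : ∀ t b c → interp t b c ≃ᵘ interpᵘ (toℚᵘ t) b c
interp-≃ᵘ t b c =
  +-≃ᵘ ((+ 1 ℚ./ 1 ℚ.+ ℚ.- t) ℚ.* (b ℚ./ 1)) (t ℚ.* (c ℚ./ 1))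
    (*-≃ᵘ (+ 1 ℚ./ 1 ℚ.+ ℚ.- t) (b ℚ./ 1)
      (+-≃ᵘ (+ 1 ℚ./ 1) (ℚ.- t) (/-≃ᵘ (+ 1) 0) (neg-≃ᵘ t ℚᵘₚ.≃-refl))
      (/-≃ᵘ b 0))
    (*-≃ᵘ t (c ℚ./ 1) ℚᵘₚ.≃-refl (/-≃ᵘ c 0))

interp-lower : ∀ t e a b c →
  a ℚ./ 1 ℚ.≤ interp t b c ℚ.+ recip e →
  a ℤ.* (ℚ.↧ t ℤ.* + suc e) ℤ.≤
  (ℚ.↧ t ℤ.* + suc e) ℤ.* b ℤ.+ (ℚ.↥ t ℤ.* + suc e) ℤ.* (c ℤ.- b) ℤ.+ ℚ.↧ t
interp-lower t@(mkℚ T d _) e a b c le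
  with ℚᵘ.*≤* le′ ← ≤-≃ᵘ (/-≃ᵘ a 0)
    (+-≃ᵘ (interp t b c) (recip e) (interp-≃ᵘ t b c) (/-≃ᵘ (+ 1) e)) le
  -- Both summands of `interpᵘ` contribute the denominator D of t, so the unreduced sum carries D
  -- twice; one copy is cancelled.
  = ℤₚ.*-cancelʳ-≤-pos _ _ (+ suc d)
      (subst₂ ℤ._≤_ (lhs a (+ suc d) (+ suc e)) (rhs T (+ suc d) (+ suc e) b c) le′)
  where
  lhs : ∀ a D N → a ℤ.* (((+ 1 ℤ.* D) ℤ.* + 1) ℤ.* (D ℤ.* + 1) ℤ.* N) ≡ a ℤ.* (D ℤ.* N) ℤ.* D
  lhs = ℤR.solve-∀
  rhs : ∀ T D N b c →
    ((((+ 1 ℤ.* D ℤ.+ (ℤ.- T) ℤ.* + 1) ℤ.* b) ℤ.* (D ℤ.* + 1)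
      ℤ.+ (T ℤ.* c) ℤ.* ((+ 1 ℤ.* D) ℤ.* + 1)) ℤ.* N
      ℤ.+ + 1 ℤ.* (((+ 1 ℤ.* D) ℤ.* + 1) ℤ.* (D ℤ.* + 1))) ℤ.* + 1
    ≡ ((D ℤ.* N) ℤ.* b ℤ.+ (T ℤ.* N) ℤ.* (c ℤ.- b) ℤ.+ D) ℤ.* D
  rhs = ℤR.solve-∀

interp-upper : ∀ t e a b c →
  interp t b c ℚ.≤ a ℚ./ 1 ℚ.+ recip e →
  (ℚ.↧ t ℤ.* + suc e) ℤ.* b ℤ.+ (ℚ.↥ t ℤ.* + suc e) ℤ.* (c ℤ.- b) ℤ.≤
  a ℤ.* (ℚ.↧ t ℤ.* + suc e) ℤ.+ ℚ.↧ t
interp-upper t@(mkℚ T d _) e a b c le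
  with ℚᵘ.*≤* le′ ← ≤-≃ᵘ (interp-≃ᵘ t b c)
    (+-≃ᵘ (a ℚ./ 1) (recip e) (/-≃ᵘ a 0) (/-≃ᵘ (+ 1) e)) le
  = ℤₚ.*-cancelʳ-≤-pos _ _ (+ suc d)
      (subst₂ ℤ._≤_ (lhs T (+ suc d) (+ suc e) b c) (rhs a (+ suc d) (+ suc e)) le′)
  where
  lhs : ∀ T D N b c →
    (((+ 1 ℤ.* D ℤ.+ (ℤ.- T) ℤ.* + 1) ℤ.* b) ℤ.* (D ℤ.* + 1)
      ℤ.+ (T ℤ.* c) ℤ.* ((+ 1 ℤ.* D) ℤ.* + 1)) ℤ.* (+ 1 ℤ.* N)
    ≡ ((D ℤ.* N) ℤ.* b ℤ.+ (T ℤ.* N) ℤ.* (c ℤ.- b)) ℤ.* D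
  lhs = ℤR.solve-∀
  rhs : ∀ a D N → (a ℤ.* N ℤ.+ + 1 ℤ.* + 1) ℤ.* (((+ 1 ℤ.* D) ℤ.* + 1) ℤ.* (D ℤ.* + 1))
    ≡ (a ℤ.* (D ℤ.* N) ℤ.+ D) ℤ.* D
  rhs = ℤR.solve-∀

time-lower : ∀ t e → + 0 ℚ./ 1 ℚ.≤ t ℚ.+ recip e →
  + 0 ℤ.≤ ℚ.↥ t ℤ.* + suc e ℤ.+ ℚ.↧ t
time-lower t@(mkℚ T d _) e le
  with ℚᵘ.*≤* le′ ← ≤-≃ᵘ (/-≃ᵘ (+ 0) 0) (+-≃ᵘ t (recip e) ℚᵘₚ.≃-refl (/-≃ᵘ (+ 1) e)) le
  = subst (+ 0 ℤ.≤_) (rhs T (+ suc d) (+ suc e)) le′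
  where
  rhs : ∀ T D N → (T ℤ.* N ℤ.+ + 1 ℤ.* D) ℤ.* + 1 ≡ T ℤ.* N ℤ.+ D
  rhs = ℤR.solve-∀

time-upper : ∀ t e → t ℚ.≤ + 1 ℚ./ 1 ℚ.+ recip e →
  ℚ.↥ t ℤ.* + suc e ℤ.≤ ℚ.↧ t ℤ.* + suc e ℤ.+ ℚ.↧ t
time-upper t@(mkℚ T d _) e le
  with ℚᵘ.*≤* le′ ← ≤-≃ᵘ ℚᵘₚ.≃-refl (+-≃ᵘ (+ 1 ℚ./ 1) (recip e) (/-≃ᵘ (+ 1) 0) (/-≃ᵘ (+ 1) e)) le
  = subst₂ ℤ._≤_ (lhs T (+ suc e)) (rhs (+ suc d) (+ suc e)) le′
  where
  lhs : ∀ T N → T ℤ.* (+ 1 ℤ.* N) ≡ T ℤ.* N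
  lhs = ℤR.solve-∀
  rhs : ∀ D N → (+ 1 ℤ.* N ℤ.+ + 1 ℤ.* + 1) ℤ.* D ≡ D ℤ.* N ℤ.+ D
  rhs = ℤR.solve-∀

-- A rational approximation θ / w, with w = (N + 1) δ, of a time at which the
-- segment from e to X + e meets the cube with corner Y; all inequalities are
-- scaled by w, and hold up to w / (N + 1) = δ.
record ApproxMeeting (e X Y : Fin 3 → ℕ) (N : ℕ) : Set where
  field
    δ-1     : ℕ
    θ       : ℤ
  δ : ℤ
  δ = + suc δ-1
  w : ℤ
  w = δ ℤ.* + suc N
  field
    0≤θ     : + 0 ℤ.≤ θ ℤ.+ δ
    θ≤w     : θ ℤ.≤ w ℤ.+ δ
    lower   : ∀ i → + Y i ℤ.* w ℤ.≤ w ℤ.* + e i ℤ.+ θ ℤ.* + X i ℤ.+ δ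
    upper   : ∀ i → w ℤ.* + e i ℤ.+ θ ℤ.* + X i ℤ.≤ + suc (Y i) ℤ.* w ℤ.+ δ

≤-max₃ : (M : Fin 3 → ℕ) → ∀ i → M i ≤ M zero ℕ.⊔ (M (suc zero) ℕ.⊔ M (suc (suc zero)))
≤-max₃ M zero = ℕₚ.m≤m⊔n _ _
≤-max₃ M (suc zero) = ℕₚ.≤-trans (ℕₚ.m≤m⊔n _ _) (ℕₚ.m≤n⊔m (M zero) _)
≤-max₃ M (suc (suc zero)) = ℕₚ.≤-trans (ℕₚ.m≤n⊔m (M (suc zero)) _) (ℕₚ.m≤n⊔m (M zero) _)

-- At tolerance 1 / (N + 1) each of the eight real inequalities, two for the time and six for the
-- coordinates, holds from some index on. One index beyond all eight thresholds yields a single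
-- rational time τ satisfying them together. Its denominator is not known in advance, hence the
-- scaling by w = (N + 1) δ.
meets⇒approxMeeting : ∀ (e X : Fin 3 → ℕ) (Y : Vec ℕ 3) N →
  SegmentMeets (λ i → fromℕ (e i)) (λ i → fromℕ (X i ℕ.+ e i)) Y →
  ApproxMeeting e X (lookup Y) N
meets⇒approxMeeting e X Y N (t , 0≤t , t≤1 , t∈Y) = record
  { δ-1   = ℚ.denominator-1 τ
  ; θ     = ℚ.↥ τ ℤ.* + suc N
  ; 0≤θ   = time-lower τ N (proj₂ (0≤t (recip N) ε>0) n
      (ℕₚ.≤-trans (ℕₚ.m≤m⊔n A B) (ℕₚ.m≤m⊔n (A ℕ.⊔ B) _)))
  ; θ≤w   = time-upper τ N (proj₂ (t≤1 (recip N) ε>0) n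
      (ℕₚ.≤-trans (ℕₚ.m≤n⊔m A B) (ℕₚ.m≤m⊔n (A ℕ.⊔ B) _)))
  ; lower = λ i → subst (λ x → + lookup Y i ℤ.* w ℤ.≤ w ℤ.* + e i ℤ.+ θ ℤ.* x ℤ.+ ℚ.↧ τ)
      -- Both endpoints are shifted by the same vertex e, so the segment has direction X.
      (difference (X i) (e i))
      (interp-lower τ N (+ lookup Y i) (+ e i) (+ (X i ℕ.+ e i))
        (proj₂ (proj₁ (t∈Y i) (recip N) ε>0) n (ℕₚ.≤-trans (ℕₚ.m≤m⊔n (P i) (Q i)) (M≤n i))))
  ; upper = λ i → subst (λ x → w ℤ.* + e i ℤ.+ θ ℤ.* x ℤ.≤ + suc (lookup Y i) ℤ.* w ℤ.+ ℚ.↧ τ)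
      (difference (X i) (e i))
      (interp-upper τ N (+ suc (lookup Y i)) (+ e i) (+ (X i ℕ.+ e i))
        (proj₂ (proj₂ (t∈Y i) (recip N) ε>0) n (ℕₚ.≤-trans (ℕₚ.m≤n⊔m (P i) (Q i)) (M≤n i))))
  }
  where
  ε>0 = recip-pos N
  A B : ℕ
  A = proj₁ (0≤t (recip N) ε>0)
  B = proj₁ (t≤1 (recip N) ε>0)
  P Q M : Fin 3 → ℕ
  P i = proj₁ (proj₁ (t∈Y i) (recip N) ε>0)
  Q i = proj₁ (proj₂ (t∈Y i) (recip N) ε>0)
  M i = P i ℕ.⊔ Q i
  n : ℕ
  n = (A ℕ.⊔ B) ℕ.⊔ (M zero ℕ.⊔ (M (suc zero) ℕ.⊔ M (suc (suc zero))))
  M≤n : ∀ i → M i ≤ n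
  M≤n i = ℕₚ.≤-trans (≤-max₃ M i) (ℕₚ.m≤n⊔m (A ℕ.⊔ B) _)
  τ = seq t n
  θ w : ℤ
  θ = ℚ.↥ τ ℤ.* + suc N
  w = ℚ.↧ τ ℤ.* + suc N
  difference : ∀ x b → + (x ℕ.+ b) ℤ.- + b ≡ + x
  difference x b = trans (cong (ℤ._- + b) (ℤₚ.pos-+ x b)) (cancel (+ x) (+ b))
    where
    cancel : ∀ x b → (x ℤ.+ b) ℤ.- b ≡ x
    cancel = ℤR.solve-∀

open ApproxMeeting using (δ-1; θ; 0≤θ; θ≤w; lower; upper)

-- The coordinate of the vertex of [0,1] minimising x ↦ z x.
minimiser : ℤ → ℕ
minimiser (+ _)    = 0
minimiser -[1+ _ ] = 1

minimiser≤1 : ∀ z → minimiser z ≤ 1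
minimiser≤1 (+ _)    = z≤n
minimiser≤1 -[1+ _ ] = s≤s z≤n

∣i∣≤n : ∀ {i n} → ℤ.- + n ℤ.≤ i → i ℤ.≤ + n → ℤ.∣ i ∣ ≤ n
∣i∣≤n {+ _} _ (ℤ.+≤+ i≤n) = i≤n
∣i∣≤n { -[1+ _ ]} {zero} () _
∣i∣≤n { -[1+ _ ]} {suc _} (ℤ.-≤- i≤n) _ = s≤s i≤n

0≤+⇒-≤ : ∀ i j → + 0 ℤ.≤ i ℤ.+ j → ℤ.- j ℤ.≤ i
0≤+⇒-≤ i j 0≤ = ℤₚ.0≤i-j⇒j≤i (subst (+ 0 ℤ.≤_) (eq i j) 0≤)
  where
  eq : ∀ i j → i ℤ.+ j ≡ i ℤ.- (ℤ.- j)
  eq = ℤR.solve-∀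

0≤+ : ∀ {i j} → + 0 ℤ.≤ i → + 0 ℤ.≤ j → + 0 ℤ.≤ i ℤ.+ j
0≤+ = ℤₚ.+-mono-≤

0≤+* : ∀ a {i} → + 0 ℤ.≤ i → + 0 ℤ.≤ + a ℤ.* i
0≤+* a {i} 0≤i = subst (ℤ._≤ + a ℤ.* i) (ℤₚ.*-zeroʳ (+ a)) (ℤₚ.*-monoˡ-≤-nonNeg (+ a) 0≤i)

∣+∣≤ : ∀ i j {a b} → ℤ.∣ i ∣ ≤ a → ℤ.∣ j ∣ ≤ b → ℤ.∣ i ℤ.+ j ∣ ≤ a ℕ.+ b
∣+∣≤ i j i≤a j≤b = ℕₚ.≤-trans (ℤₚ.∣i+j∣≤∣i∣+∣j∣ i j) (ℕₚ.+-mono-≤ i≤a j≤b)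

∣-∣≤ : ∀ i j {a b} → ℤ.∣ i ∣ ≤ a → ℤ.∣ j ∣ ≤ b → ℤ.∣ i ℤ.- j ∣ ≤ a ℕ.+ b
∣-∣≤ i j i≤a j≤b = ℕₚ.≤-trans (ℤₚ.∣i-j∣≤∣i∣+∣j∣ i j) (ℕₚ.+-mono-≤ i≤a j≤b)

∣*∣≤ : ∀ i j {a b} → ℤ.∣ i ∣ ≤ a → ℤ.∣ j ∣ ≤ b → ℤ.∣ i ℤ.* j ∣ ≤ a ℕ.* b
∣*∣≤ i j {a} {b} i≤a j≤b =
  subst (_≤ a ℕ.* b) (sym (ℤₚ.abs-* i j)) (ℕₚ.*-mono-≤ i≤a j≤b)

-- Scaled displacements at a meeting, and the separation of cells.

module _ {e X Y : Fin 3 → ℕ} {N : ℕ} (A : ApproxMeeting e X Y N) where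

  scale slack : ℕ
  scale = suc (δ-1 A) ℕ.* suc N
  slack = suc (δ-1 A)

  -- This is w (t X - Y) at the time t = θ / w. A meeting places it in w ([0,1]³ - e), up to the
  -- slack δ in each coordinate.
  offset : Fin 3 → ℤ
  offset i = θ A ℤ.* + X i ℤ.- + scale ℤ.* + Y i

  slack≤scale : slack ≤ scale
  slack≤scale = ℕₚ.m≤m*n slack (suc N)

  private
    slackℤ scaleℤ : ℤ
    slackℤ = + slack
    scaleℤ = + scale

  ∣time∣≤ : ℤ.∣ θ A ∣ ≤ scale ℕ.+ slack
  ∣time∣≤ = ∣i∣≤n
    (ℤₚ.≤-trans (ℤₚ.neg-mono-≤ (ℤ.+≤+ (ℕₚ.m≤n+m slack scale)))
      (0≤+⇒-≤ (θ A) slackℤ (0≤θ A)))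
    (θ≤w A)

  offset-lower : ∀ i → + 0 ℤ.≤ offset i ℤ.+ (scaleℤ ℤ.* + e i ℤ.+ slackℤ)
  offset-lower i = subst (+ 0 ℤ.≤_)
    (eq (θ A) (+ X i) scaleℤ (+ Y i) (+ e i) slackℤ)
    (ℤₚ.i≤j⇒0≤j-i (lower A i))
    where
    eq : ∀ t x w y a d → (w ℤ.* a ℤ.+ t ℤ.* x ℤ.+ d) ℤ.- y ℤ.* w ≡
      (t ℤ.* x ℤ.- w ℤ.* y) ℤ.+ (w ℤ.* a ℤ.+ d)
    eq = ℤR.solve-∀

  offset-upper : ∀ i → + 0 ℤ.≤ (scaleℤ ℤ.- scaleℤ ℤ.* + e i) ℤ.+ slackℤ ℤ.- offset i
  offset-upper i = subst (+ 0 ℤ.≤_)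
    (eq (θ A) (+ X i) scaleℤ (+ Y i) (+ e i) slackℤ)
    (ℤₚ.i≤j⇒0≤j-i (upper A i))
    where
    eq : ∀ t x w y a d → ((+ 1 ℤ.+ y) ℤ.* w ℤ.+ d) ℤ.- (w ℤ.* a ℤ.+ t ℤ.* x) ≡
      (w ℤ.- w ℤ.* a) ℤ.+ d ℤ.- (t ℤ.* x ℤ.- w ℤ.* y)
    eq = ℤR.solve-∀

  ∣offset∣≤ : ∀ i → e i ≤ 1 → ℤ.∣ offset i ∣ ≤ scale ℕ.+ slack
  ∣offset∣≤ i e≤1 = ∣i∣≤n
    (ℤₚ.≤-trans (ℤₚ.neg-mono-≤ (ℤₚ.+-monoˡ-≤ slackℤ we≤w)) (0≤+⇒-≤ (offset i) _ (offset-lower i)))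
    (ℤₚ.≤-trans (ℤₚ.0≤i-j⇒j≤i (offset-upper i)) (ℤₚ.+-monoˡ-≤ slackℤ w-we≤w))
    where
    we≤w : scaleℤ ℤ.* + e i ℤ.≤ scaleℤ
    we≤w = subst (scaleℤ ℤ.* + e i ℤ.≤_) (ℤₚ.*-identityʳ scaleℤ)
      (ℤₚ.*-monoˡ-≤-nonNeg scaleℤ (ℤ.+≤+ e≤1))
    w-we≤w : scaleℤ ℤ.- scaleℤ ℤ.* + e i ℤ.≤ scaleℤ
    w-we≤w = ℤₚ.0≤i-j⇒j≤i (subst (+ 0 ℤ.≤_)
      (eq scaleℤ (scaleℤ ℤ.* + e i)) (0≤+* scale {+ e i} (ℤ.+≤+ z≤n)))
      where
      eq : ∀ a b → b ≡ a ℤ.- (a ℤ.- b)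
      eq = ℤR.solve-∀

  -- For z ≥ 0 the vertex coordinate is 0 and the offset is at least -δ; for z < 0 it is 1 and the
  -- offset is at most δ. Added over the coordinates of a normal N, this is the approximate form of
  -- N · (t X - Y) ≥ 0.
  minimiser-offset : ∀ i z → e i ≡ minimiser z →
    + 0 ℤ.≤ z ℤ.* offset i ℤ.+ + ℤ.∣ z ∣ ℤ.* slackℤ
  minimiser-offset i (+ a) eq = subst (+ 0 ℤ.≤_) (id₁ (+ a) (offset i) scaleℤ slackℤ)
    (0≤+* a (subst (λ b → + 0 ℤ.≤ offset i ℤ.+ (scaleℤ ℤ.* + b ℤ.+ slackℤ)) eq (offset-lower i)))
    where
    id₁ : ∀ a v w d → a ℤ.* (v ℤ.+ (w ℤ.* + 0 ℤ.+ d)) ≡ a ℤ.* v ℤ.+ a ℤ.* d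
    id₁ = ℤR.solve-∀
  minimiser-offset i -[1+ a ] eq = subst (+ 0 ℤ.≤_) (id₂ (+ suc a) (offset i) scaleℤ slackℤ)
    (0≤+* (suc a) (subst
      (λ b → + 0 ℤ.≤ (scaleℤ ℤ.- scaleℤ ℤ.* + b) ℤ.+ slackℤ ℤ.- offset i) eq (offset-upper i)))
    where
    id₂ : ∀ a v w d → a ℤ.* ((w ℤ.- w ℤ.* + 1) ℤ.+ d ℤ.- v) ≡ (ℤ.- a) ℤ.* v ℤ.+ a ℤ.* d
    id₂ = ℤR.solve-∀

-- i / L is the slope of the direction of X in coordinate c.
slopes-agree : ∀ {e X Y N} (A : ApproxMeeting e X Y N) → (∀ i → e i ≤ 1) →
  ∀ c {L i i′} → .{{_ : ℕ.NonZero L}} → i ≤ L →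
  ℤ.∣ + L ℤ.* + X c ℤ.- + X 0F ℤ.* + i ∣ ≤ L →
  ℤ.∣ + L ℤ.* + Y c ℤ.- + Y 0F ℤ.* + i′ ∣ ≤ L →
  8 ℕ.* L ≤ Y 0F → i ≡ i′
slopes-agree {e} {X} {Y} {N} A e≤1 c {L} {i} {i′} i≤L ∣g∣≤L ∣g′∣≤L 8L≤k′
  with i ℕₚ.≟ i′
... | yes i≡i′ = i≡i′
... | no  i≢i′ = contradiction (ℕₚ.≤-trans lower-bound upper-bound) (ℕₚ.<⇒≱ strict)
  where
  w = scale A
  k′ = Y 0F
  g  = + L ℤ.* + X c ℤ.- + X 0F ℤ.* + i
  g′ = + L ℤ.* + Y c ℤ.- + k′ ℤ.* + i′
  diff = + i ℤ.- + i′
  -- The four terms of `identity`, with offsets and θ at most 2 w in absolute value, add up to at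
  -- most 7 w L. If i and i′ differed, the left side would be at least w k′ ≥ 8 w L.
  bound = ((L ℕ.* (w ℕ.+ w) ℕ.+ L ℕ.* (w ℕ.+ w)) ℕ.+ (w ℕ.+ w) ℕ.* L) ℕ.+ w ℕ.* L
  1≤∣diff∣ : 1 ≤ ℤ.∣ diff ∣
  1≤∣diff∣ = ℕₚ.n≢0⇒n>0 λ d≡0 →
    i≢i′ (ℤₚ.+-injective (ℤₚ.i-j≡0⇒i≡j (+ i) (+ i′) (ℤₚ.∣i∣≡0⇒i≡0 d≡0)))
  identity : ∀ i i′ w k′ L θ x k y′ →
    (i ℤ.- i′) ℤ.* (w ℤ.* k′) ≡
    ((L ℤ.* (θ ℤ.* x ℤ.- w ℤ.* y′) ℤ.- i ℤ.* (θ ℤ.* k ℤ.- w ℤ.* k′))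
      ℤ.- θ ℤ.* (L ℤ.* x ℤ.- k ℤ.* i)) ℤ.+ w ℤ.* (L ℤ.* y′ ℤ.- k′ ℤ.* i′)
  identity = ℤR.solve-∀
  upper-bound : ℤ.∣ diff ℤ.* (+ w ℤ.* + k′) ∣ ≤ bound
  upper-bound = subst (λ z → ℤ.∣ z ∣ ≤ bound)
    (sym (identity (+ i) (+ i′) (+ w) (+ k′) (+ L) (θ A) (+ X c) (+ X 0F) (+ Y c)))
    (∣+∣≤ (Lv ℤ.- iv ℤ.- θ A ℤ.* g) (+ w ℤ.* g′)
      (∣-∣≤ (Lv ℤ.- iv) (θ A ℤ.* g)
        (∣-∣≤ Lv iv (∣*∣≤ (+ L) (offset A c) ℕₚ.≤-refl (∣v∣≤2w c))
                         (∣*∣≤ (+ i) (offset A 0F) i≤L (∣v∣≤2w 0F)))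
        (∣*∣≤ (θ A) g (ℕₚ.≤-trans (∣time∣≤ A) w+δ≤2w) ∣g∣≤L))
      (∣*∣≤ (+ w) g′ ℕₚ.≤-refl ∣g′∣≤L))
    where
    Lv = + L ℤ.* offset A c
    iv = + i ℤ.* offset A 0F
    w+δ≤2w = ℕₚ.+-monoʳ-≤ w (slack≤scale A)
    ∣v∣≤2w : ∀ j → ℤ.∣ offset A j ∣ ≤ w ℕ.+ w
    ∣v∣≤2w j = ℕₚ.≤-trans (∣offset∣≤ A j (e≤1 j)) w+δ≤2w
  lower-bound : w ℕ.* (8 ℕ.* L) ≤ ℤ.∣ diff ℤ.* (+ w ℤ.* + k′) ∣
  lower-bound = begin
    w ℕ.* (8 ℕ.* L)                  ≤⟨ ℕₚ.*-monoʳ-≤ w 8L≤k′ ⟩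
    w ℕ.* k′                         ≡⟨ ℕₚ.*-identityˡ _ ⟨
    1 ℕ.* (w ℕ.* k′)                 ≤⟨ ℕₚ.*-monoˡ-≤ (w ℕ.* k′) 1≤∣diff∣ ⟩
    ℤ.∣ diff ∣ ℕ.* (w ℕ.* k′)        ≡⟨ cong (ℤ.∣ diff ∣ ℕ.*_) (ℤₚ.abs-* (+ w) (+ k′)) ⟨
    ℤ.∣ diff ∣ ℕ.* ℤ.∣ + w ℤ.* + k′ ∣  ≡⟨ ℤₚ.abs-* diff (+ w ℤ.* + k′) ⟨
    ℤ.∣ diff ℤ.* (+ w ℤ.* + k′) ∣    ∎
    where open ℕₚ.≤-Reasoning
  strict : bound ℕ.< w ℕ.* (8 ℕ.* L)
  strict = subst₂ ℕ._<_ refl (sym (total L w)) (ℕₚ.m<m+n _ (ℕ.>-nonZero⁻¹ _ {{ℕₚ.m*n≢0 w L}}))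
    where
    total : ∀ L w → w ℕ.* (8 ℕ.* L) ≡
      (((L ℕ.* (w ℕ.+ w) ℕ.+ L ℕ.* (w ℕ.+ w)) ℕ.+ (w ℕ.+ w) ℕ.* L) ℕ.+ w ℕ.* L) ℕ.+ w ℕ.* L
    total = ℕR.solve-∀

-- Meetings between points of one level.

plane : (p q r : ℤ) → (Fin 3 → ℕ) → ℤ
plane p q r X = p ℤ.* + X 0F ℤ.+ q ℤ.* + X 1F ℤ.+ r ℤ.* + X 2F

norm₁ : ℤ → ℤ → ℤ → ℕ
norm₁ p q r = ℤ.∣ p ∣ ℕ.+ ℤ.∣ q ∣ ℕ.+ ℤ.∣ r ∣

-- With S the norm of the normal, the common level and the choice of e give (θ - w) (c + 1) ≥ -δ S,
-- so the time falls short of 1 by at most δ S / w. The identity w (k - k′) = `offset` 0 + (w - θ) k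
-- then bounds the difference of the depths. As the time is known only approximately, the outcome is
-- a difference below 2 instead of equality; the precision is chosen large enough to absorb the
-- factor k.
coplanar⇒close : ∀ {e X Y} p q r c →
  ApproxMeeting e X Y (suc (suc (norm₁ p q r) ℕ.* X 0F)) → (∀ i → e i ≤ 1) →
  e 0F ≡ minimiser p → e 1F ≡ minimiser q → e 2F ≡ minimiser r →
  plane p q r X ≡ +[1+ c ] → plane p q r Y ≡ +[1+ c ] →
  ℤ.∣ + X 0F ℤ.- + Y 0F ∣ ≤ 1
coplanar⇒close {e} {X} {Y} p q r c A e≤1 e₀ e₁ e₂ X∈ Y∈ =
  ℕₚ.≤-pred (ℕₚ.*-cancelˡ-< w _ 2 (ℕₚ.≤-<-trans w∣k-k′∣≤ strict))
  where
  w = scale A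
  δ = slack A
  S = norm₁ p q r
  k = X 0F
  M = suc S ℕ.* k
  lag = + w ℤ.- θ A
  identity : ∀ p q r x y z x′ y′ z′ w θ c →
    p ℤ.* x ℤ.+ q ℤ.* y ℤ.+ r ℤ.* z ≡ c → p ℤ.* x′ ℤ.+ q ℤ.* y′ ℤ.+ r ℤ.* z′ ≡ c →
    p ℤ.* (θ ℤ.* x ℤ.- w ℤ.* x′) ℤ.+ q ℤ.* (θ ℤ.* y ℤ.- w ℤ.* y′) ℤ.+ r ℤ.* (θ ℤ.* z ℤ.- w ℤ.* z′)
    ≡ θ ℤ.* c ℤ.- w ℤ.* c
  identity p q r x y z x′ y′ z′ w θ c eq eq′ = trans (regroup p q r x y z x′ y′ z′ w θ)
    (cong₂ (λ a b → θ ℤ.* a ℤ.- w ℤ.* b) eq eq′)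
    where
    regroup : ∀ p q r x y z x′ y′ z′ w θ →
      p ℤ.* (θ ℤ.* x ℤ.- w ℤ.* x′) ℤ.+ q ℤ.* (θ ℤ.* y ℤ.- w ℤ.* y′) ℤ.+ r ℤ.* (θ ℤ.* z ℤ.- w ℤ.* z′)
      ≡ θ ℤ.* (p ℤ.* x ℤ.+ q ℤ.* y ℤ.+ r ℤ.* z) ℤ.- w ℤ.* (p ℤ.* x′ ℤ.+ q ℤ.* y′ ℤ.+ r ℤ.* z′)
    regroup = ℤR.solve-∀
  lag*c≤ : lag ℤ.* +[1+ c ] ℤ.≤ + (δ ℕ.* S)
  lag*c≤ = ℤₚ.0≤i-j⇒j≤i (subst (+ 0 ℤ.≤_)
    (trans (collect p q r (offset A 0F) (offset A 1F) (offset A 2F)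
        (+ ℤ.∣ p ∣) (+ ℤ.∣ q ∣) (+ ℤ.∣ r ∣) (+ δ))
      (trans (cong (ℤ._+ + δ ℤ.* + S)
        (identity p q r (+ k) (+ X 1F) (+ X 2F) (+ Y 0F) (+ Y 1F) (+ Y 2F)
          (+ w) (θ A) +[1+ c ] X∈ Y∈))
        (trans (swap (θ A) (+ w) +[1+ c ] (+ δ ℤ.* + S))
          (cong (ℤ._- (lag ℤ.* +[1+ c ])) (sym (ℤₚ.pos-* δ S))))))
    (0≤+ (0≤+ (minimiser-offset A 0F p e₀) (minimiser-offset A 1F q e₁))
      (minimiser-offset A 2F r e₂)))
    where
    collect : ∀ p q r u v t a b c d →
      ((p ℤ.* u ℤ.+ a ℤ.* d) ℤ.+ (q ℤ.* v ℤ.+ b ℤ.* d)) ℤ.+ (r ℤ.* t ℤ.+ c ℤ.* d)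
      ≡ (p ℤ.* u ℤ.+ q ℤ.* v ℤ.+ r ℤ.* t) ℤ.+ d ℤ.* (a ℤ.+ b ℤ.+ c)
    collect = ℤR.solve-∀
    swap : ∀ t w c s → (t ℤ.* c ℤ.- w ℤ.* c) ℤ.+ s ≡ s ℤ.- (w ℤ.- t) ℤ.* c
    swap = ℤR.solve-∀
  lag≤ : lag ℤ.≤ + (δ ℕ.* S)
  lag≤ with ℤₚ.≤-total lag (+ 0)
  ... | inj₁ lag≤0 = ℤₚ.≤-trans lag≤0 (ℤ.+≤+ z≤n)
  -- The level is a positive integer, so dropping it as a factor only decreases a nonnegative lag.
  ... | inj₂ 0≤lag = ℤₚ.≤-trans
    (subst (ℤ._≤ lag ℤ.* +[1+ c ]) (ℤₚ.*-identityʳ lag)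
      (ℤₚ.*-monoˡ-≤-nonNeg lag {{ℤ.nonNegative 0≤lag}} (ℤ.+≤+ (s≤s z≤n))))
    lag*c≤
  ∣lag∣≤ : ℤ.∣ lag ∣ ≤ δ ℕ.* suc S
  -- The time may also exceed 1, by at most δ / w; the factor S + 1 covers both sides, even for S =
  -- 0.
  ∣lag∣≤ = ∣i∣≤n
    (ℤₚ.≤-trans (ℤₚ.neg-mono-≤ (ℤ.+≤+ (ℕₚ.m≤m*n δ (suc S))))
      (0≤+⇒-≤ lag (+ δ) (subst (+ 0 ℤ.≤_) (flip (+ w) (θ A) (+ δ)) (ℤₚ.i≤j⇒0≤j-i (θ≤w A)))))
    (ℤₚ.≤-trans lag≤ (ℤ.+≤+ (ℕₚ.*-monoʳ-≤ δ (ℕₚ.n≤1+n S))))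
    where
    flip : ∀ w t d → (w ℤ.+ d) ℤ.- t ≡ (w ℤ.- t) ℤ.+ d
    flip = ℤR.solve-∀
  w∣k-k′∣≤ : w ℕ.* ℤ.∣ + k ℤ.- + Y 0F ∣ ≤ (w ℕ.+ δ) ℕ.+ δ ℕ.* suc S ℕ.* k
  w∣k-k′∣≤ = subst (_≤ (w ℕ.+ δ) ℕ.+ δ ℕ.* suc S ℕ.* k)
    (trans (cong ℤ.∣_∣ (eq (θ A) (+ k) (+ w) (+ Y 0F))) (ℤₚ.abs-* (+ w) (+ k ℤ.- + Y 0F)))
    (∣+∣≤ (offset A 0F) (lag ℤ.* + k) (∣offset∣≤ A 0F (e≤1 0F)) (∣*∣≤ lag (+ k) ∣lag∣≤ ℕₚ.≤-refl))
    where
    eq : ∀ t x w y → (t ℤ.* x ℤ.- w ℤ.* y) ℤ.+ (w ℤ.- t) ℤ.* x ≡ w ℤ.* (x ℤ.- y)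
    eq = ℤR.solve-∀
  strict : (w ℕ.+ δ) ℕ.+ δ ℕ.* suc S ℕ.* k ℕ.< w ℕ.* 2
  -- The chosen precision makes w = δ (2 + (S + 1) k), so 2 w exceeds the bound by exactly δ.
  strict = subst ((w ℕ.+ δ) ℕ.+ δ ℕ.* suc S ℕ.* k ℕ.<_) (total δ (suc S) k)
    (ℕₚ.m<m+n ((w ℕ.+ δ) ℕ.+ δ ℕ.* suc S ℕ.* k) (s≤s z≤n))
    where
    total : ∀ d s k → (d ℕ.* suc (suc (s ℕ.* k)) ℕ.+ d) ℕ.+ d ℕ.* s ℕ.* k ℕ.+ d
      ≡ d ℕ.* suc (suc (s ℕ.* k)) ℕ.* 2
    total = ℕR.solve-∀

-- Integer vectors almost orthogonal to a direction, and strict rounding.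

∣⊖∣≤ : ∀ {a b m} → a ≤ m → b ≤ m → ℤ.∣ + a ℤ.- + b ∣ ≤ m
∣⊖∣≤ {a} {b} {m} a≤m b≤m = subst (λ z → ℤ.∣ z ∣ ≤ m) (sym (ℤₚ.m-n≡m⊖n a b))
  (ℕₚ.≤-trans (ℤₚ.∣m⊝n∣≤m⊔n a b) (ℕₚ.⊔-lub a≤m b≤m))

∣-∣≡0⇒≡ : ∀ a b → ℤ.∣ + a ℤ.- + b ∣ ≡ 0 → a ≡ b
∣-∣≡0⇒≡ a b eq = ℤₚ.+-injective (ℤₚ.i-j≡0⇒i≡j (+ a) (+ b) (ℤₚ.∣i∣≡0⇒i≡0 eq))

pos-∸ : ∀ {a b} → b ≤ a → + (a ℕ.∸ b) ≡ + a ℤ.- + b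
pos-∸ {a} {b} b≤a = sym (trans (ℤₚ.m-n≡m⊖n a b) (ℤₚ.⊖-≥ b≤a))

-- The normal N = (p, q, r) for the direction (L, i, j), with its sign chosen so that the product b
-- is a natural number. The field `nontrivial` concerns q and r because the rounding of these two
-- coordinates is what makes levels positive.
record SmallRelation (m L i j : ℕ) : Set where
  field
    p q r      : ℤ
    b          : ℕ
    b<m        : b ℕ.< m
    relation   : p ℤ.* + L ℤ.+ q ℤ.* + i ℤ.+ r ℤ.* + j ≡ + b
    ∣q∣≤m      : ℤ.∣ q ∣ ≤ m
    ∣r∣≤m      : ℤ.∣ r ∣ ≤ m
    nontrivial : 1 ≤ ℤ.∣ q ∣ ℕ.+ ℤ.∣ r ∣

/-≡⇒∸< : ∀ a b m → .{{_ : NonZero m}} → a ≤ b → a ℕ./ m ≡ b ℕ./ m → b ℕ.∸ a ℕ.< m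
/-≡⇒∸< a b m a≤b eq = ℕₚ.m<n+o⇒m∸n<o b a (begin-strict
  b                          ≡⟨ ℕD.m≡m%n+[m/n]*n b m ⟩
  b ℕ.% m ℕ.+ b ℕ./ m ℕ.* m  ≡⟨ cong (λ x → b ℕ.% m ℕ.+ x ℕ.* m) eq ⟨
  b ℕ.% m ℕ.+ a ℕ./ m ℕ.* m  <⟨ ℕₚ.+-mono-<-≤ (ℕD.m%n<n b m) (ℕD.m/n*n≤m a m) ⟩
  m ℕ.+ a                    ≡⟨ ℕₚ.+-comm m a ⟩
  a ℕ.+ m                    ∎)
  where open ℕₚ.≤-Reasoning

module _ (m : ℕ) .{{_ : NonZero m}} (i j : ℕ) where
  private
    instance
      L≢0 : NonZero (m ^ 3)
      L≢0 = ℕₚ.m^n≢0 m 3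

    L : ℕ
    L = m ^ 3

    form residue : ℕ → ℕ → ℕ
    form u v = u ℕ.* i ℕ.+ v ℕ.* j
    residue u v = form u v ℕ.% L

    -- Subtract two divisions with remainder by L: the quotients combine to p and the remainders to
    -- b. Remainders in one interval of length m differ by less than m, and their order decides
    -- which pair is subtracted.
    from-collision : ∀ {u v u′ v′} → u ≤ m → v ≤ m → u′ ≤ m → v′ ≤ m →
      ¬ (u ≡ u′ × v ≡ v′) → residue u v ≤ residue u′ v′ →
      residue u v ℕ./ m ≡ residue u′ v′ ℕ./ m → SmallRelation m L i j
    from-collision {u} {v} {u′} {v′} u≤ v≤ u′≤ v′≤ distinct s≤s′ same = record
      { p = + d ℤ.- + d′
      ; q = + u′ ℤ.- + u
      ; r = + v′ ℤ.- + v
      ; b = residue u′ v′ ℕ.∸ residue u v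
      ; b<m = /-≡⇒∸< (residue u v) (residue u′ v′) m s≤s′ same
      ; relation = trans
          (rearrange (+ d) (+ d′) (+ u) (+ u′) (+ v) (+ v′) (+ L) (+ i) (+ j))
          (trans (cong₂ (λ x y → (x ℤ.- + d′ ℤ.* + L) ℤ.- (y ℤ.- + d ℤ.* + L))
              (split u′ v′) (split u v))
            (trans (cancel (+ s′) (+ d′ ℤ.* + L) (+ s) (+ d ℤ.* + L)) (sym (pos-∸ s≤s′))))
      ; ∣q∣≤m = ∣⊖∣≤ u′≤ u≤
      ; ∣r∣≤m = ∣⊖∣≤ v′≤ v≤
      ; nontrivial = ℕₚ.n≢0⇒n>0 λ ≡0 → distinct
          ( sym (∣-∣≡0⇒≡ u′ u (ℕₚ.m+n≡0⇒m≡0 _ ≡0))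
          , sym (∣-∣≡0⇒≡ v′ v (ℕₚ.m+n≡0⇒n≡0 ℤ.∣ + u′ ℤ.- + u ∣ ≡0)))
      }
      where
      d  = form u v ℕ./ L
      d′ = form u′ v′ ℕ./ L
      s  = residue u v
      s′ = residue u′ v′
      split : ∀ u v → + u ℤ.* + i ℤ.+ + v ℤ.* + j ≡ + residue u v ℤ.+ + (form u v ℕ./ L) ℤ.* + L
      split u v = begin
        + u ℤ.* + i ℤ.+ + v ℤ.* + j
          ≡⟨ cong₂ ℤ._+_ (sym (ℤₚ.pos-* u i)) (sym (ℤₚ.pos-* v j)) ⟩
        + form u v
          ≡⟨ cong +_ (ℕD.m≡m%n+[m/n]*n (form u v) L) ⟩
        + residue u v ℤ.+ + (form u v ℕ./ L ℕ.* L)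
          ≡⟨ cong (λ z → + residue u v ℤ.+ z) (ℤₚ.pos-* (form u v ℕ./ L) L) ⟩
        + residue u v ℤ.+ + (form u v ℕ./ L) ℤ.* + L ∎
        where open ≡-Reasoning
      rearrange : ∀ d d′ u u′ v v′ L i j →
        (d ℤ.- d′) ℤ.* L ℤ.+ (u′ ℤ.- u) ℤ.* i ℤ.+ (v′ ℤ.- v) ℤ.* j ≡
        ((u′ ℤ.* i ℤ.+ v′ ℤ.* j) ℤ.- d′ ℤ.* L) ℤ.- ((u ℤ.* i ℤ.+ v ℤ.* j) ℤ.- d ℤ.* L)
      rearrange = ℤR.solve-∀
      cancel : ∀ a b c e → ((a ℤ.+ b) ℤ.- b) ℤ.- ((c ℤ.+ e) ℤ.- e) ≡ a ℤ.- c
      cancel = ℤR.solve-∀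

    residue/m< : ∀ u v → residue u v ℕ./ m ℕ.< m ℕ.* m
    residue/m< u v = ℕD.m<n*o⇒m/o<n (subst (residue u v ℕ.<_) (cube-pos m) (ℕD.m%n<n (form u v) L))

    pair : Fin (suc m ℕ.* suc m) → Fin (suc m) × Fin (suc m)
    pair = Fin.remQuot (suc m)

    pair-injective : ∀ {x y} → toℕ (proj₁ (pair x)) ≡ toℕ (proj₁ (pair y)) →
      toℕ (proj₂ (pair x)) ≡ toℕ (proj₂ (pair y)) → x ≡ y
    pair-injective {x} {y} eq₁ eq₂ = trans (sym (Finₚ.combine-remQuot (suc m) x))
      (trans (cong₂ Fin.combine (Finₚ.toℕ-injective eq₁) (Finₚ.toℕ-injective eq₂))
        (Finₚ.combine-remQuot (suc m) y))

    toℕ≤m : (u : Fin (suc m)) → toℕ u ≤ m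
    toℕ≤m u = ℕₚ.≤-pred (Finₚ.toℕ<n u)

  -- Dirichlet's pigeonhole: (m + 1)² residues modulo m³, m² intervals of length m.
  abstract
    smallRelation : SmallRelation m (m ^ 3) i j
    smallRelation
      with x , y , x<y , same ← Finₚ.pigeonhole (ℕₚ.*-mono-< (ℕₚ.n<1+n m) (ℕₚ.n<1+n m))
        (λ x → Fin.fromℕ< (residue/m< (toℕ (proj₁ (pair x))) (toℕ (proj₂ (pair x)))))
      with same′ ← trans (sym (Finₚ.toℕ-fromℕ< _)) (trans (cong toℕ same) (Finₚ.toℕ-fromℕ< _))
      with ℕₚ.≤-total (residue (toℕ (proj₁ (pair x))) (toℕ (proj₂ (pair x))))
                      (residue (toℕ (proj₁ (pair y))) (toℕ (proj₂ (pair y))))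
    ... | inj₁ x≤y = from-collision (toℕ≤m (proj₁ (pair x))) (toℕ≤m (proj₂ (pair x)))
        (toℕ≤m (proj₁ (pair y))) (toℕ≤m (proj₂ (pair y)))
        (λ (eq₁ , eq₂) → Finₚ.<⇒≢ x<y (pair-injective eq₁ eq₂)) x≤y same′
    ... | inj₂ y≤x = from-collision (toℕ≤m (proj₁ (pair y))) (toℕ≤m (proj₂ (pair y)))
        (toℕ≤m (proj₁ (pair x))) (toℕ≤m (proj₂ (pair x)))
        (λ (eq₁ , eq₂) → Finₚ.<⇒≢ x<y (sym (pair-injective eq₁ eq₂))) y≤x (sym same′)

-- Rounding k i / L strictly upwards if q ≥ 0 and strictly downwards if q < 0
-- makes q (L y − k i) ≥ |q|, which keeps the levels N · X positive.
rounded : ℤ → (L i k : ℕ) → .{{_ : NonZero L}} → ℕ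
rounded (+ _)    L i k = suc (k ℕ.* i ℕ./ L)
rounded -[1+ _ ] L i k = (k ℕ.* i ℕ.∸ 1) ℕ./ L

-- Strict rounding moves k i / L by a nonzero amount of at most 1, hence a gap between 1 and L after
-- scaling. The direction of rounding follows q, so the product with q has no sign left.
rounded-gap : ∀ q L i k → .{{_ : NonZero L}} → 1 ≤ k ℕ.* i →
  let g = + L ℤ.* + rounded q L i k ℤ.- + k ℤ.* + i in
  ∃[ t ] (1 ≤ t) × (t ≤ L) × (ℤ.∣ g ∣ ≡ t) × (q ℤ.* g ≡ + (ℤ.∣ q ∣ ℕ.* t))
rounded-gap (+ a) L i k 1≤P =
  t , ℕₚ.m<n⇒0<n∸m P<Ly , ℕₚ.m≤n+o⇒m∸n≤o (L ℕ.* y) P Ly≤P+L ,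
  cong ℤ.∣_∣ g≡t , trans (cong (+ a ℤ.*_) g≡t) (sym (ℤₚ.pos-* a t))
  where
  P = k ℕ.* i
  y = suc (P ℕ./ L)
  t = L ℕ.* y ℕ.∸ P
  open ℕₚ.≤-Reasoning
  Ly≡ : L ℕ.* y ≡ P ℕ./ L ℕ.* L ℕ.+ L
  Ly≡ = trans (ℕₚ.*-comm L y) (ℕₚ.+-comm L (P ℕ./ L ℕ.* L))
  P<Ly : P ℕ.< L ℕ.* y
  P<Ly = begin-strict
    P                          ≡⟨ ℕD.m≡m%n+[m/n]*n P L ⟩
    P ℕ.% L ℕ.+ P ℕ./ L ℕ.* L  <⟨ ℕₚ.+-monoˡ-< (P ℕ./ L ℕ.* L) (ℕD.m%n<n P L) ⟩
    L ℕ.+ P ℕ./ L ℕ.* L        ≡⟨ ℕₚ.*-comm y L ⟩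
    L ℕ.* y                    ∎
  Ly≤P+L : L ℕ.* y ≤ P ℕ.+ L
  Ly≤P+L = begin
    L ℕ.* y              ≡⟨ Ly≡ ⟩
    P ℕ./ L ℕ.* L ℕ.+ L  ≤⟨ ℕₚ.+-monoˡ-≤ L (ℕD.m/n*n≤m P L) ⟩
    P ℕ.+ L              ∎
  g≡t : + L ℤ.* + y ℤ.- + k ℤ.* + i ≡ + t
  g≡t = trans (cong₂ ℤ._-_ (sym (ℤₚ.pos-* L y)) (sym (ℤₚ.pos-* k i))) (sym (pos-∸ (ℕₚ.<⇒≤ P<Ly)))
rounded-gap -[1+ a ] L i k 1≤P =
  t , ℕₚ.m<n⇒0<n∸m Ly<P , ℕₚ.m≤n+o⇒m∸n≤o P (L ℕ.* y) P≤Ly+L ,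
  trans (cong ℤ.∣_∣ g≡-t) (ℤₚ.∣-i∣≡∣i∣ (+ t)) ,
  trans (cong (-[1+ a ] ℤ.*_) g≡-t)
    (trans (double-neg (+ suc a) (+ t)) (sym (ℤₚ.pos-* (suc a) t)))
  where
  P = k ℕ.* i
  -- As P is positive, this is the largest integer strictly below P / L, also when L divides P.
  y = (P ℕ.∸ 1) ℕ./ L
  t = P ℕ.∸ L ℕ.* y
  open ℕₚ.≤-Reasoning
  P≡ : P ≡ suc (P ℕ.∸ 1)
  P≡ = sym (ℕₚ.m+[n∸m]≡n 1≤P)
  Ly<P : L ℕ.* y ℕ.< P
  Ly<P = begin-strict
    L ℕ.* y  ≡⟨ ℕₚ.*-comm L y ⟩
    y ℕ.* L  ≤⟨ ℕD.m/n*n≤m (P ℕ.∸ 1) L ⟩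
    P ℕ.∸ 1  <⟨ ℕₚ.≤-reflexive (sym P≡) ⟩
    P        ∎
  P≤Ly+L : P ≤ L ℕ.* y ℕ.+ L
  P≤Ly+L = begin
    P                                ≡⟨ P≡ ⟩
    suc (P ℕ.∸ 1)                    ≡⟨ cong suc (ℕD.m≡m%n+[m/n]*n (P ℕ.∸ 1) L) ⟩
    suc ((P ℕ.∸ 1) ℕ.% L) ℕ.+ y ℕ.* L  ≤⟨ ℕₚ.+-monoˡ-≤ (y ℕ.* L) (ℕD.m%n<n (P ℕ.∸ 1) L) ⟩
    L ℕ.+ y ℕ.* L                    ≡⟨ ℕₚ.+-comm L (y ℕ.* L) ⟩
    y ℕ.* L ℕ.+ L                    ≡⟨ cong (ℕ._+ L) (ℕₚ.*-comm y L) ⟩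
    L ℕ.* y ℕ.+ L                    ∎
  negate : ∀ a b → a ℤ.- b ≡ ℤ.- (b ℤ.- a)
  negate = ℤR.solve-∀
  double-neg : ∀ a b → (ℤ.- a) ℤ.* (ℤ.- b) ≡ a ℤ.* b
  double-neg = ℤR.solve-∀
  g≡-t : + L ℤ.* + y ℤ.- + k ℤ.* + i ≡ ℤ.- + t
  g≡-t = trans (cong₂ ℤ._-_ (sym (ℤₚ.pos-* L y)) (sym (ℤₚ.pos-* k i)))
    (trans (negate (+ (L ℕ.* y)) (+ P)) (cong ℤ.-_ (sym (pos-∸ (ℕₚ.<⇒≤ Ly<P)))))

-- Pigeonhole principle for the fibres of a list.

length-filter-∷ : ∀ {A : Set} {P : Pred A 0ℓ} (P? : Decidable P) x xs →
  length (filter P? xs) ≤ length (filter P? (x ∷ xs))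
length-filter-∷ P? x xs with does (P? x)
... | true  = ℕₚ.n≤1+n _
... | false = ℕₚ.≤-refl

length-filter-⊎ : ∀ {A : Set} {P Q R : Pred A 0ℓ}
  (P? : Decidable P) (Q? : Decidable Q) (R? : Decidable R) →
  (∀ x → P x → Q x ⊎ R x) → ∀ xs →
  length (filter P? xs) ≤ length (filter Q? xs) ℕ.+ length (filter R? xs)
length-filter-⊎ P? Q? R? split [] = z≤n
length-filter-⊎ P? Q? R? split (x ∷ xs) with P? x
... | no _ = ℕₚ.≤-trans (length-filter-⊎ P? Q? R? split xs)
  (ℕₚ.+-mono-≤ (length-filter-∷ Q? x xs) (length-filter-∷ R? x xs))
... | yes px with split x px
...   | inj₁ qx rewrite Listₚ.filter-accept Q? {xs = xs} qx = s≤s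
  (ℕₚ.≤-trans (length-filter-⊎ P? Q? R? split xs)
    (ℕₚ.+-monoʳ-≤ _ (length-filter-∷ R? x xs)))
...   | inj₂ rx rewrite Listₚ.filter-accept R? {xs = xs} rx
    | ℕₚ.+-suc (length (filter Q? (x ∷ xs))) (length (filter R? xs)) = s≤s
  (ℕₚ.≤-trans (length-filter-⊎ P? Q? R? split xs)
    (ℕₚ.+-monoˡ-≤ _ (length-filter-∷ Q? x xs)))

module _ {A : Set} (f : A → ℕ) where

  fibre : ℕ → List A → List A
  fibre c = filter λ x → f x ℕₚ.≟ c

  private
    below : ℕ → List A → List A
    below M = filter λ x → f x ℕₚ.<? M

    below-suc : ∀ M xs → length (below (suc M) xs) ≤ length (below M xs) ℕ.+ length (fibre M xs)
    below-suc M = length-filter-⊎ _ _ _ λ x → ℕₚ.m<1+n⇒m<n∨m≡n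

    -- Induction on M, keeping the longer of the new fibre and the best one so far.
    below≤*fibre : ∀ M xs → ∃[ c ] length (below M xs) ≤ M ℕ.* length (fibre c xs)
    -- No value lies below 0, so the level returned here is arbitrary.
    below≤*fibre zero xs = 0 , ℕₚ.≤-reflexive
      (cong length (Listₚ.filter-none (λ x → f x ℕₚ.<? 0) (All.universal (λ _ ()) xs)))
    below≤*fibre (suc M) xs with c , ih ← below≤*fibre M xs
      with ℕₚ.≤-total (length (fibre M xs)) (length (fibre c xs))
    ... | inj₁ le = c , ℕₚ.≤-trans (below-suc M xs)
      (ℕₚ.≤-trans (ℕₚ.+-mono-≤ ih le)
        (ℕₚ.≤-reflexive (ℕₚ.+-comm (M ℕ.* length (fibre c xs)) _)))
    ... | inj₂ ge = M , ℕₚ.≤-trans (below-suc M xs)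
      (ℕₚ.≤-trans (ℕₚ.+-monoˡ-≤ _ (ℕₚ.≤-trans ih (ℕₚ.*-monoʳ-≤ M ge)))
        (ℕₚ.≤-reflexive (ℕₚ.+-comm (M ℕ.* length (fibre M xs)) _)))

  pigeonhole-fibre : ∀ M xs → All (λ x → f x ℕ.< M) xs →
    ∃[ c ] length xs ≤ M ℕ.* length (fibre c xs)
  pigeonhole-fibre M xs f< with c , le ← below≤*fibre M xs
    = c , subst (_≤ M ℕ.* length (fibre c xs)) (cong length (Listₚ.filter-all _ f<)) le

-- Levels of the lattice points of one cell.

quotient-bounds : ∀ z L V M → .{{_ : NonZero L}} → z ℤ.* + L ≡ + V → 1 ≤ V → V ℕ.< M ℕ.* L →
  ∃[ c ] (z ≡ +[1+ c ]) × (suc c ℕ.< M)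
quotient-bounds -[1+ _ ] (suc _) _ _ () _ _
quotient-bounds (+ zero) L V M eq 1≤V _ = contradiction (ℤₚ.+-injective eq) (ℕₚ.<⇒≢ 1≤V)
quotient-bounds +[1+ c ] L V M eq _ V<ML = c , refl ,
  ℕₚ.*-cancelʳ-< L (suc c) M (subst (ℕ._< M ℕ.* L)
    (sym (ℤₚ.+-injective (trans (ℤₚ.pos-* (suc c) L) eq))) V<ML)

-- A lattice point next to (k, k i / L, k j / L), the point of the ray of direction (L, i, j) at
-- depth k.
point : (q r : ℤ) (L i j k : ℕ) → .{{_ : NonZero L}} → Fin 3 → ℕ
point q r L i j k 0F = k
point q r L i j k 1F = rounded q L i k
point q r L i j k 2F = rounded r L j k

module _ {m L i j : ℕ} .{{_ : NonZero L}} (R : SmallRelation m L i j) where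
  open SmallRelation R

  -- L times the level is k b plus the two rounding terms |q| t and |r| u. The rounding terms make
  -- it positive, since t, u ≥ 1 and q or r is nonzero; the three terms are bounded by 10 L m, m L
  -- and m L.
  plane-bounds : ∀ k → 1 ≤ k ℕ.* i → 1 ≤ k ℕ.* j → k ℕ.< 10 ℕ.* L →
    ∃[ c ] (plane p q r (point q r L i j k) ≡ +[1+ c ]) × (suc c ℕ.< 12 ℕ.* m)
  plane-bounds k 1≤ki 1≤kj k<10L
    with t , 1≤t , t≤L , _ , qg≡ ← rounded-gap q L i k 1≤ki
    with u , 1≤u , u≤L , _ , rh≡ ← rounded-gap r L j k 1≤kj
    = quotient-bounds (plane p q r (point q r L i j k)) L V (12 ℕ.* m) plane*L≡V 1≤V V<
    where
    y = rounded q L i k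
    z = rounded r L j k
    V = k ℕ.* b ℕ.+ (ℤ.∣ q ∣ ℕ.* t ℕ.+ ℤ.∣ r ∣ ℕ.* u)
    identity : ∀ p q r L i j k y z →
      (p ℤ.* k ℤ.+ q ℤ.* y ℤ.+ r ℤ.* z) ℤ.* L ≡
      k ℤ.* (p ℤ.* L ℤ.+ q ℤ.* i ℤ.+ r ℤ.* j) ℤ.+
      (q ℤ.* (L ℤ.* y ℤ.- k ℤ.* i) ℤ.+ r ℤ.* (L ℤ.* z ℤ.- k ℤ.* j))
    identity = ℤR.solve-∀
    plane*L≡V : plane p q r (point q r L i j k) ℤ.* + L ≡ + V
    plane*L≡V = trans (identity p q r (+ L) (+ i) (+ j) (+ k) (+ y) (+ z))
      (cong₂ ℤ._+_ (trans (cong (+ k ℤ.*_) relation) (sym (ℤₚ.pos-* k b))) (cong₂ ℤ._+_ qg≡ rh≡))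
    1≤V : 1 ≤ V
    1≤V = begin
      1
        ≤⟨ nontrivial ⟩
      ℤ.∣ q ∣ ℕ.+ ℤ.∣ r ∣
        ≡⟨ cong₂ ℕ._+_ (ℕₚ.*-identityʳ ℤ.∣ q ∣) (ℕₚ.*-identityʳ ℤ.∣ r ∣) ⟨
      ℤ.∣ q ∣ ℕ.* 1 ℕ.+ ℤ.∣ r ∣ ℕ.* 1
        ≤⟨ ℕₚ.+-mono-≤ (ℕₚ.*-monoʳ-≤ ℤ.∣ q ∣ 1≤t) (ℕₚ.*-monoʳ-≤ ℤ.∣ r ∣ 1≤u) ⟩
      ℤ.∣ q ∣ ℕ.* t ℕ.+ ℤ.∣ r ∣ ℕ.* u
        ≤⟨ ℕₚ.m≤n+m _ (k ℕ.* b) ⟩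
      V ∎
      where open ℕₚ.≤-Reasoning
    V< : V ℕ.< 12 ℕ.* m ℕ.* L
    V< = begin-strict
      V
        <⟨ ℕₚ.+-mono-<-≤ (ℕₚ.*-mono-< k<10L b<m)
          (ℕₚ.+-mono-≤ (ℕₚ.*-mono-≤ ∣q∣≤m t≤L) (ℕₚ.*-mono-≤ ∣r∣≤m u≤L)) ⟩
      10 ℕ.* L ℕ.* m ℕ.+ (m ℕ.* L ℕ.+ m ℕ.* L)
        ≡⟨ total L m ⟩
      12 ℕ.* m ℕ.* L ∎
      where
      open ℕₚ.≤-Reasoning
      total : ∀ L m → 10 ℕ.* L ℕ.* m ℕ.+ (m ℕ.* L ℕ.+ m ℕ.* L) ≡ 12 ℕ.* m ℕ.* L
      total = ℕR.solve-∀

rounded-∣gap∣≤ : ∀ q L i k → .{{_ : NonZero L}} → 1 ≤ k ℕ.* i →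
  ℤ.∣ + L ℤ.* + rounded q L i k ℤ.- + k ℤ.* + i ∣ ≤ L
rounded-∣gap∣≤ q L i k 1≤ki with t , _ , t≤L , g≡t , _ ← rounded-gap q L i k 1≤ki
  = subst (_≤ L) (sym g≡t) t≤L

rounded≤ : ∀ q L i k → .{{_ : NonZero L}} → i ≤ L → rounded q L i k ≤ suc k
rounded≤ (+ _) L i k i≤L = s≤s (ℕₚ.≤-trans
  (ℕD./-monoˡ-≤ L (ℕₚ.*-monoʳ-≤ k i≤L))
  (ℕₚ.≤-reflexive (ℕD.m*n/n≡m k L)))
rounded≤ -[1+ _ ] L i k i≤L = ℕₚ.m≤n⇒m≤1+n (ℕₚ.≤-trans
  (ℕD./-monoˡ-≤ L (ℕₚ.≤-trans (ℕₚ.m∸n≤m (k ℕ.* i) 1) (ℕₚ.*-monoʳ-≤ k i≤L)))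
  (ℕₚ.≤-reflexive (ℕD.m*n/n≡m k L)))

-- Lists of pairs and their lengths.

module _ {A B : Set} (f : A → List B) where

  tagged : List A → List (A × B)
  tagged = concatMap λ a → map (a ,_) (f a)

  ∈-tagged⁻ : ∀ {a b} xs → (a , b) ∈ tagged xs → a ∈ xs × b ∈ f a
  ∈-tagged⁻ (x ∷ xs) ab∈ with ∈ₚ.∈-++⁻ (map (x ,_) (f x)) ab∈
  ... | inj₂ ab∈xs = Product.map₁ there (∈-tagged⁻ xs ab∈xs)
  ... | inj₁ ab∈x with _ , b∈ , refl ← ∈ₚ.∈-map⁻ (x ,_) ab∈x = here refl , b∈

  tagged-unique : (∀ a → Unique (f a)) → ∀ {xs} → Unique xs → Unique (tagged xs)
  tagged-unique f! [] = []
  tagged-unique f! {x ∷ xs} (x∉ ∷ xs!) = Uniqueₚ.++⁺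
    (Uniqueₚ.map⁺ ,-injectiveʳ (f! x)) (tagged-unique f! xs!) disjoint
    where
    disjoint : ∀ {v} → ¬ (v ∈ map (x ,_) (f x) × v ∈ tagged xs)
    disjoint (∈₁ , ∈₂) with _ , _ , refl ← ∈ₚ.∈-map⁻ (x ,_) ∈₁
      = All.lookup x∉ (proj₁ (∈-tagged⁻ xs ∈₂)) refl

  -- The factor M avoids a division: each inner list has at least B / M entries.
  length-tagged : ∀ B M → (∀ a → B ≤ M ℕ.* length (f a)) →
    ∀ xs → length xs ℕ.* B ≤ M ℕ.* length (tagged xs)
  length-tagged B M B≤ [] = z≤n
  length-tagged B M B≤ (x ∷ xs) = begin
    B ℕ.+ length xs ℕ.* B
      ≤⟨ ℕₚ.+-mono-≤ (B≤ x) (length-tagged B M B≤ xs) ⟩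
    M ℕ.* length (f x) ℕ.+ M ℕ.* length (tagged xs)
      ≡⟨ ℕₚ.*-distribˡ-+ M (length (f x)) (length (tagged xs)) ⟨
    M ℕ.* (length (f x) ℕ.+ length (tagged xs))
      ≡⟨ cong (λ l → M ℕ.* (l ℕ.+ length (tagged xs))) (Listₚ.length-map (x ,_) (f x)) ⟨
    M ℕ.* (length (map (x ,_) (f x)) ℕ.+ length (tagged xs))
      ≡⟨ cong (M ℕ.*_) (Listₚ.length-++ (map (x ,_) (f x))) ⟨
    M ℕ.* length (tagged (x ∷ xs)) ∎
    where open ℕₚ.≤-Reasoning

-- Configurations given by families of lattice points.

approx-resp : ∀ {e X Y Y′ N} → (∀ i → Y i ≡ Y′ i) →
  ApproxMeeting e X Y N → ApproxMeeting e X Y′ N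
approx-resp Y≗Y′ A = record
  { δ-1   = δ-1 A
  ; θ     = θ A
  ; 0≤θ   = 0≤θ A
  ; θ≤w   = θ≤w A
  ; lower = λ i → subst (λ y → + y ℤ.* ApproxMeeting.w A ℤ.≤ _) (Y≗Y′ i) (lower A i)
  ; upper = λ i → subst
      (λ y → _ ℤ.≤ + suc y ℤ.* ApproxMeeting.w A ℤ.+ ApproxMeeting.δ A)
      (Y≗Y′ i) (upper A i)
  }

-- At time 1 the segment from the origin reaches the corner of its own cube. Through this meeting,
-- the separation of cells also shows that different cells yield different cubes.
approx-self : ∀ X → ApproxMeeting (λ _ → 0) X X 0
approx-self X = record
  { δ-1   = 0
  ; θ     = + 1
  ; 0≤θ   = ℤ.+≤+ z≤n
  ; θ≤w   = ℤ.+≤+ (s≤s z≤n)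
  ; lower = λ i → ℤₚ.0≤i-j⇒j≤i (subst (+ 0 ℤ.≤_) (sym (eqₗ (+ X i))) (ℤ.+≤+ z≤n))
  ; upper = λ i → ℤₚ.0≤i-j⇒j≤i (subst (+ 0 ℤ.≤_) (sym (eqᵤ (+ X i))) (ℤ.+≤+ z≤n))
  }
  where
  eqₗ : ∀ x → (+ 1 ℤ.* + 0 ℤ.+ + 1 ℤ.* x ℤ.+ + 1) ℤ.- x ℤ.* + 1 ≡ + 1
  eqₗ = ℤR.solve-∀
  eqᵤ : ∀ x → ((+ 1 ℤ.+ x) ℤ.* + 1 ℤ.+ + 1) ℤ.- (+ 1 ℤ.* + 0 ℤ.+ + 1 ℤ.* x) ≡ + 2
  eqᵤ = ℤR.solve-∀

module _ {n : ℕ} where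

  cube : (X : Fin 3 → ℕ) → (∀ i → X i ℕ.< n) → Cube n
  cube X X<n = tabulate λ i → Fin.fromℕ< (X<n i)

  corner-cube : ∀ X X<n i → lookup (corner (cube X X<n)) i ≡ X i
  corner-cube X X<n i = trans (Vecₚ.lookup-map i toℕ (cube X X<n))
    (trans (cong toℕ (Vecₚ.lookup∘tabulate (λ j → Fin.fromℕ< (X<n j)) i)) (Finₚ.toℕ-fromℕ< (X<n i)))

  _∈?_ : (Q : Cube n) (Qs : List (Cube n)) → _
  _∈?_ = DecMembership._∈?_ (Vecₚ.≡-dec Finₚ._≟_)

  module _ {I : Set} (X : I → Fin 3 → ℕ) (X<n : ∀ a i → X a i ℕ.< n) where

    cubeOf : I → Cube n
    cubeOf a = cube (X a) (X<n a)

    imageConfiguration : (∀ a → 0 ℕ.< X a 0F) → List I → Configuration n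
    imageConfiguration 0<X as = record
      { Obstructing    = _∈ map cubeOf as
      ; obstructing?   = _∈? map cubeOf as
      ; observer-empty = ∉observer
      }
      where
      ∉observer : ∀ Q → Q ∈ map cubeOf as → corner Q ≢ observer
      ∉observer Q Q∈ eq with a , _ , refl ← ∈ₚ.∈-map⁻ cubeOf Q∈ = ℕₚ.<⇒≢ (0<X a)
        (trans (sym (cong (λ v → lookup v 0F) eq)) (corner-cube (X a) (X<n a) 0F))

    -- The line of sight joins the vertex e of the observer to the same vertex of the target cube. A
    -- true meeting is an approximate one at every precision, so each candidate obstruction may be
    -- excluded at a precision of its own.
    visible-along : ∀ 0<X as e a → (∀ i → e i ≤ 1) → a ∈ as →
      (∀ a′ → a′ ∈ as → ∃[ N ] (ApproxMeeting e (X a) (X a′) N → a ≡ a′)) →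
      Visible (imageConfiguration 0<X as) (cubeOf a)
    visible-along 0<X as e a e≤1 a∈ meets-itself =
      ∈ₚ.∈-map⁺ cubeOf a∈ , (λ i → fromℕ (e i)) , (λ i → fromℕ (X a i ℕ.+ e i)) ,
      (λ i → subst (λ l → (fromℕ l ≤ᵣ fromℕ (e i)) × (fromℕ (e i) ≤ᵣ fromℕ (suc l)))
        (sym (Vecₚ.lookup-replicate i 0))
        (fromℕ-mono-≤ 0 (e i) z≤n , fromℕ-mono-≤ (e i) 1 (e≤1 i))) ,
      (λ i → subst
        (λ l → (fromℕ l ≤ᵣ fromℕ (X a i ℕ.+ e i)) × (fromℕ (X a i ℕ.+ e i) ≤ᵣ fromℕ (suc l)))
        (sym (corner-cube (X a) (X<n a) i))
        ( fromℕ-mono-≤ (X a i) (X a i ℕ.+ e i) (ℕₚ.m≤m+n (X a i) (e i))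
        , fromℕ-mono-≤ (X a i ℕ.+ e i) (suc (X a i))
            (ℕₚ.≤-trans (ℕₚ.+-monoʳ-≤ (X a i) (e≤1 i)) (ℕₚ.≤-reflexive (ℕₚ.+-comm (X a i) 1))))) ,
      unobstructed
      where
      unobstructed : ∀ Q → Q ∈ map cubeOf as → Q ≢ cubeOf a →
        ¬ SegmentMeets (λ i → fromℕ (e i)) (λ i → fromℕ (X a i ℕ.+ e i)) (corner Q)
      unobstructed Q Q∈ Q≢ meets with a′ , a′∈ , refl ← ∈ₚ.∈-map⁻ cubeOf Q∈
        with N , itself ← meets-itself a′ a′∈ = Q≢ (cong cubeOf (sym (itself
          (approx-resp (corner-cube (X a′) (X<n a′))
            (meets⇒approxMeeting e (X a) (corner (cubeOf a′)) N meets)))))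

-- The configuration, its size and the visibility of its cubes.

module Construction (m : ℕ) .{{_ : NonZero m}} (n : ℕ) (27m³≤n : 27 ℕ.* m ^ 3 ≤ n) where

  L : ℕ
  L = m ^ 3

  private instance
    L≢0 : NonZero L
    L≢0 = ℕₚ.m^n≢0 m 3

  Cell Index : Set
  Cell = Fin L × Fin L
  Index = Cell × Fin L

  -- Starting at 1 keeps k i positive, as strict rounding downwards requires.
  numerator : Fin L → ℕ
  numerator i = suc (toℕ i)

  -- With steps of 2, two depths of a cell that differ by at most 1 are equal.
  depth : Fin L → ℕ
  depth h = 8 ℕ.* L ℕ.+ 2 ℕ.* toℕ h

  -- From depth 8 L on, `slopes-agree` separates neighbouring cells.
  8L≤depth : ∀ h → 8 ℕ.* L ≤ depth h
  8L≤depth h = ℕₚ.m≤m+n (8 ℕ.* L) _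

  0<depth : ∀ h → 0 ℕ.< depth h
  0<depth h = ℕₚ.<-≤-trans (ℕ.>-nonZero⁻¹ (8 ℕ.* L) {{ℕₚ.m*n≢0 8 L}}) (8L≤depth h)

  depth<10L : ∀ h → depth h ℕ.< 10 ℕ.* L
  depth<10L h = ℕₚ.<-≤-trans (ℕₚ.+-monoʳ-< (8 ℕ.* L) (ℕₚ.*-monoʳ-< 2 (Finₚ.toℕ<n h)))
    (ℕₚ.≤-reflexive (sym (ℕₚ.*-distribʳ-+ L 8 2)))

  depth-close⇒≡ : ∀ h h′ → ℤ.∣ + depth h ℤ.- + depth h′ ∣ ≤ 1 → h ≡ h′
  depth-close⇒≡ h h′ close = Finₚ.toℕ-injective (∣-∣≡0⇒≡ (toℕ h) (toℕ h′)
    (ℕₚ.n<1⇒n≡0 (ℕₚ.*-cancelˡ-< 2 _ 1 (s≤s (subst (_≤ 1) (trans (cong ℤ.∣_∣ eq)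
      (ℤₚ.abs-* (+ 2) (+ toℕ h ℤ.- + toℕ h′))) close)))))
    where
    expand : ∀ a x y → (a ℤ.+ + 2 ℤ.* x) ℤ.- (a ℤ.+ + 2 ℤ.* y) ≡ + 2 ℤ.* (x ℤ.- y)
    expand = ℤR.solve-∀
    eq : + depth h ℤ.- + depth h′ ≡ + 2 ℤ.* (+ toℕ h ℤ.- + toℕ h′)
    eq = trans (cong₂ (λ u v → (+ (8 ℕ.* L) ℤ.+ u) ℤ.- (+ (8 ℕ.* L) ℤ.+ v))
      (ℤₚ.pos-* 2 (toℕ h)) (ℤₚ.pos-* 2 (toℕ h′))) (expand (+ (8 ℕ.* L)) (+ toℕ h) (+ toℕ h′))

  1≤depth*numerator : ∀ h i → 1 ≤ depth h ℕ.* numerator i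
  1≤depth*numerator h i = ℕₚ.*-mono-≤ (0<depth h) (s≤s z≤n)

  relationAt : ∀ ((i , j) : Cell) → SmallRelation m L (numerator i) (numerator j)
  relationAt (i , j) = smallRelation m (numerator i) (numerator j)

  pointAt : Index → Fin 3 → ℕ
  pointAt (ij@(i , j) , h) = point q r L (numerator i) (numerator j) (depth h)
    where open SmallRelation (relationAt ij)

  heightAt : Index → ℤ
  heightAt a@(ij , _) = plane p q r (pointAt a)
    where open SmallRelation (relationAt ij)

  heightAt-bounds : ∀ a → ∃[ c ] (heightAt a ≡ +[1+ c ]) × (suc c ℕ.< 12 ℕ.* m)
  heightAt-bounds (ij@(i , j) , h) = plane-bounds (relationAt ij) (depth h)
    (1≤depth*numerator h i) (1≤depth*numerator h j) (depth<10L h)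

  pointAt<n : ∀ a i → pointAt a i ℕ.< n
  pointAt<n a@(ij@(i , j) , h) c = ℕₚ.<-≤-trans (ℕₚ.≤-<-trans (bound c) 1+depth<27L) 27m³≤n
    where
    open SmallRelation (relationAt ij)
    bound : ∀ c → pointAt a c ≤ suc (depth h)
    bound 0F = ℕₚ.n≤1+n _
    bound 1F = rounded≤ q L (numerator i) (depth h) (Finₚ.toℕ<n i)
    bound 2F = rounded≤ r L (numerator j) (depth h) (Finₚ.toℕ<n j)
    1+depth<27L : suc (depth h) ℕ.< 27 ℕ.* L
    1+depth<27L = ℕₚ.≤-<-trans (depth<10L h) (ℕₚ.*-monoˡ-< L (ℕₚ.<ᵇ⇒< 10 27 _))

  -- Heights are positive, so passing to absolute values for the pigeonhole principle merges no
  -- levels.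
  absHeight : Cell → Fin L → ℕ
  absHeight ij h = ℤ.∣ heightAt (ij , h) ∣

  length-allFin : length (allFin L) ≡ L
  length-allFin = Listₚ.length-tabulate {n = L} (λ h → h)

  popularLevel : ∀ ij → ∃[ c ]
    length (allFin L) ≤ 12 ℕ.* m ℕ.* length (fibre (absHeight ij) c (allFin L))
  popularLevel ij = pigeonhole-fibre (absHeight ij) (12 ℕ.* m) (allFin L)
    (All.universal bounded (allFin L))
    where
    bounded : ∀ h → absHeight ij h ℕ.< 12 ℕ.* m
    bounded h = let _ , eq , c< = heightAt-bounds (ij , h) in
      ℕₚ.≤-<-trans (ℕₚ.≤-reflexive (cong ℤ.∣_∣ eq)) c<

  selected : Cell → List (Fin L)
  selected ij = fibre (absHeight ij) (proj₁ (popularLevel ij)) (allFin L)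

  -- The m · m² depths of a cell are spread over fewer than 12 m levels, and the most popular one is
  -- kept.
  selected-large : ∀ ij → m ^ 2 ≤ 12 ℕ.* length (selected ij)
  selected-large ij = ℕₚ.*-cancelˡ-≤ m (begin
    m ℕ.* m ^ 2                          ≡⟨ length-allFin ⟨
    length (allFin L)                    ≤⟨ proj₂ (popularLevel ij) ⟩
    12 ℕ.* m ℕ.* length (selected ij)    ≡⟨ rearrange m (length (selected ij)) ⟩
    m ℕ.* (12 ℕ.* length (selected ij))  ∎)
    where
    open ℕₚ.≤-Reasoning
    rearrange : ∀ m l → 12 ℕ.* m ℕ.* l ≡ m ℕ.* (12 ℕ.* l)
    rearrange = ℕR.solve-∀

  cells : List Cell
  cells = tagged (λ _ → allFin L) (allFin L)

  indices : List Index
  indices = tagged selected cells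

  indices-unique : Unique indices
  indices-unique = tagged-unique selected (λ ij → Uniqueₚ.filter⁺ _ (Uniqueₚ.allFin⁺ L))
    (tagged-unique _ (λ _ → Uniqueₚ.allFin⁺ L) (Uniqueₚ.allFin⁺ L))

  length-indices : m ^ 8 ≤ 12 ℕ.* length indices
  length-indices = begin
    m ^ 8                         ≡⟨ ℕₚ.^-distribˡ-+-* m 6 2 ⟩
    -- There are L² = m⁶ cells, each contributing at least m² / 12 depths.
    m ^ 6 ℕ.* m ^ 2               ≤⟨ ℕₚ.*-monoˡ-≤ (m ^ 2) m⁶≤ ⟩
    length cells ℕ.* m ^ 2        ≤⟨ length-tagged selected (m ^ 2) 12 selected-large cells ⟩
    12 ℕ.* length indices         ∎
    where
    open ℕₚ.≤-Reasoning
    m⁶≤ : m ^ 6 ≤ length cells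
    m⁶≤ = begin
      m ^ 6                        ≡⟨ ℕₚ.^-distribˡ-+-* m 3 3 ⟩
      L ℕ.* L                      ≡⟨ cong (ℕ._* L) length-allFin ⟨
      length (allFin L) ℕ.* L      ≤⟨ length-tagged (λ _ → allFin L) L 1
        (λ _ → ℕₚ.≤-reflexive (trans (sym length-allFin) (sym (ℕₚ.*-identityˡ _)))) (allFin L) ⟩
      1 ℕ.* length cells           ≡⟨ ℕₚ.*-identityˡ _ ⟩
      length cells                 ∎

  slope-gap₁ : ∀ (a@((i , _) , _) : Index) →
    ℤ.∣ + L ℤ.* + pointAt a 1F ℤ.- + pointAt a 0F ℤ.* + numerator i ∣ ≤ L
  slope-gap₁ (ij@(i , _) , h) = rounded-∣gap∣≤ (SmallRelation.q (relationAt ij)) L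
    (numerator i) (depth h) (1≤depth*numerator h i)

  slope-gap₂ : ∀ (a@((_ , j) , _) : Index) →
    ℤ.∣ + L ℤ.* + pointAt a 2F ℤ.- + pointAt a 0F ℤ.* + numerator j ∣ ≤ L
  slope-gap₂ (ij@(_ , j) , h) = rounded-∣gap∣≤ (SmallRelation.r (relationAt ij)) L
    (numerator j) (depth h) (1≤depth*numerator h j)

  numerator-injective : ∀ {i i′} → numerator i ≡ numerator i′ → i ≡ i′
  numerator-injective eq = Finₚ.toℕ-injective (ℕₚ.suc-injective eq)

  meeting⇒sameCell : ∀ (a@(ij , _) a′@(ij′ , _) : Index) {e N} → (∀ c → e c ≤ 1) →
    ApproxMeeting e (pointAt a) (pointAt a′) N → ij ≡ ij′
  meeting⇒sameCell a@((i , j) , h) a′@((i′ , j′) , h′) e≤1 A = cong₂ _,_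
    (numerator-injective (slopes-agree A e≤1 1F (Finₚ.toℕ<n i)
      (slope-gap₁ a) (slope-gap₁ a′) (8L≤depth h′)))
    (numerator-injective (slopes-agree A e≤1 2F (Finₚ.toℕ<n j)
      (slope-gap₂ a) (slope-gap₂ a′) (8L≤depth h′)))

  vertexAt : Cell → Fin 3 → ℕ
  vertexAt ij 0F = minimiser (SmallRelation.p (relationAt ij))
  vertexAt ij 1F = minimiser (SmallRelation.q (relationAt ij))
  vertexAt ij 2F = minimiser (SmallRelation.r (relationAt ij))

  vertexAt≤1 : ∀ ij c → vertexAt ij c ≤ 1
  vertexAt≤1 ij 0F = minimiser≤1 _
  vertexAt≤1 ij 1F = minimiser≤1 _
  vertexAt≤1 ij 2F = minimiser≤1 _

  -- The tolerance demanded by `coplanar⇒close`; it depends on the viewed cube alone.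
  precision : Index → ℕ
  precision (ij , h) = suc (suc (norm₁ p q r) ℕ.* depth h)
    where open SmallRelation (relationAt ij)

  meeting⇒sameDepth : ∀ ij h h′ → h ∈ selected ij → h′ ∈ selected ij →
    ApproxMeeting (vertexAt ij) (pointAt (ij , h)) (pointAt (ij , h′)) (precision (ij , h)) → h ≡ h′
  meeting⇒sameDepth ij h h′ h∈ h′∈ A =
    let c  , eq  , _ = heightAt-bounds (ij , h)
        c′ , eq′ , _ = heightAt-bounds (ij , h′)
    in depth-close⇒≡ h h′ (coplanar⇒close p q r c A (vertexAt≤1 ij) refl refl refl eq
        (trans eq′ (cong +_ (trans (sym (cong ℤ.∣_∣ eq′))
          (trans (level h′∈) (trans (sym (level h∈)) (cong ℤ.∣_∣ eq)))))))
    where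
    open SmallRelation (relationAt ij)
    level : ∀ {h} → h ∈ selected ij → ℤ.∣ heightAt (ij , h) ∣ ≡ proj₁ (popularLevel ij)
    level h∈ = proj₂ (∈ₚ.∈-filter⁻ _ {xs = allFin L} h∈)

  0<pointAt : ∀ a → 0 ℕ.< pointAt a 0F
  0<pointAt (_ , h) = 0<depth h

  cubeAt : Index → Cube n
  cubeAt = cubeOf pointAt pointAt<n

  cubeAt-injective : ∀ {a a′} → cubeAt a ≡ cubeAt a′ → a ≡ a′
  cubeAt-injective {a@(ij , h)} {a′@(ij′ , h′)} eq = cong₂ _,_
    (meeting⇒sameCell a a′ (λ _ → z≤n) (approx-resp same (approx-self (pointAt a))))
    (depth-close⇒≡ h h′ (∣i-i∣≤1 (same 0F)))
    where
    same : ∀ i → pointAt a i ≡ pointAt a′ i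
    same i = trans (sym (corner-cube (pointAt a) (pointAt<n a) i))
      (trans (cong (λ Q → lookup (corner Q) i) eq) (corner-cube (pointAt a′) (pointAt<n a′) i))
    ∣i-i∣≤1 : ∀ {x y} → x ≡ y → ℤ.∣ + x ℤ.- + y ∣ ≤ 1
    ∣i-i∣≤1 {x} refl = ℕₚ.≤-trans (ℕₚ.≤-reflexive (cong ℤ.∣_∣ (ℤₚ.+-inverseʳ (+ x)))) z≤n

  configuration : Configuration n
  configuration = imageConfiguration pointAt pointAt<n 0<pointAt indices

  cubes : List (Cube n)
  cubes = map cubeAt indices

  length-cubes : m ^ 8 ≤ 12 ℕ.* length cubes
  length-cubes = subst (λ l → m ^ 8 ≤ 12 ℕ.* l)
    (sym (Listₚ.length-map cubeAt indices)) length-indices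

  cubes-unique : Unique cubes
  cubes-unique = Uniqueₚ.map⁺ cubeAt-injective indices-unique

  -- The equality of cells comes as an argument because matching on it gives both points the same
  -- normal and the same selected level.
  meeting⇒≡ : ∀ ij ij′ h h′ → ij ≡ ij′ → h ∈ selected ij → h′ ∈ selected ij′ →
    ApproxMeeting (vertexAt ij) (pointAt (ij , h)) (pointAt (ij′ , h′)) (precision (ij , h)) →
    (ij , h) ≡ (ij′ , h′)
  meeting⇒≡ ij _ h h′ refl h∈ h′∈ A = cong (ij ,_) (meeting⇒sameDepth ij h h′ h∈ h′∈ A)

  visible : ∀ a → a ∈ indices → Visible configuration (cubeAt a)
  visible a@(ij , h) a∈ = visible-along pointAt pointAt<n 0<pointAt indices
    (vertexAt ij) a (vertexAt≤1 ij) a∈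
    λ a′@(ij′ , h′) a′∈ → precision a , λ A →
      meeting⇒≡ ij ij′ h h′ (meeting⇒sameCell a a′ (vertexAt≤1 ij) A)
        (proj₂ (∈-tagged⁻ selected cells a∈)) (proj₂ (∈-tagged⁻ selected cells a′∈)) A

  all-visible : All (Visible configuration) cubes
  all-visible = Allₚ.map⁺ (All.tabulate λ {a} → visible a)

-- Choice of m and of the constant.

cbrt-third : ∀ n → 27 ≤ n → ∃[ m ] (1 ≤ m) × (27 ℕ.* m ^ 3 ≤ n) × (n ≤ (6 ℕ.* m) ^ 3)
cbrt-third n 27≤n with a , a³≤n , n<[1+a]³ ← floor-cbrt n
  = m , 1≤m ,
    ℕₚ.≤-trans (ℕₚ.≤-reflexive (sym (cube-* 3 m))) (ℕₚ.≤-trans (ℕₚ.^-monoˡ-≤ 3 3m≤a) a³≤n) ,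
    ℕₚ.≤-trans (ℕₚ.<⇒≤ n<[1+a]³) (ℕₚ.^-monoˡ-≤ 3 1+a≤6m)
  where
  -- Then (3 m)³ ≤ a³ ≤ n, while a + 1 ≤ 3 m + 3 ≤ 6 m because n ≥ 27 forces a ≥ 3 and so m ≥ 1.
  m = a ℕ./ 3
  3≤a : 3 ≤ a
  3≤a = ℕₚ.≤-pred (cube-cancel-< (ℕₚ.≤-<-trans 27≤n n<[1+a]³))
  1≤m : 1 ≤ m
  1≤m = ℕD./-monoˡ-≤ 3 3≤a
  3m≤a : 3 ℕ.* m ≤ a
  3m≤a = ℕₚ.≤-trans (ℕₚ.≤-reflexive (ℕₚ.*-comm 3 m)) (ℕD.m/n*n≤m a 3)
  1+a≤6m : suc a ≤ 6 ℕ.* m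
  1+a≤6m = begin-strict
    a                      ≡⟨ ℕD.m≡m%n+[m/n]*n a 3 ⟩
    a ℕ.% 3 ℕ.+ m ℕ.* 3    <⟨ ℕₚ.+-monoˡ-< (m ℕ.* 3) (ℕD.m%n<n a 3) ⟩
    3 ℕ.+ m ℕ.* 3          ≤⟨ ℕₚ.+-monoˡ-≤ (m ℕ.* 3) (ℕₚ.*-monoʳ-≤ 3 1≤m) ⟩
    3 ℕ.* m ℕ.+ m ℕ.* 3    ≡⟨ total m ⟩
    6 ℕ.* m                ∎
    where
    open ℕₚ.≤-Reasoning
    total : ∀ m → 3 ℕ.* m ℕ.+ m ℕ.* 3 ≡ 6 ℕ.* m
    total = ℕR.solve-∀

^8≤cube : ∀ n x → n ≤ x ^ 3 → n ^ 8 ≤ (x ^ 8) ^ 3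
^8≤cube n x n≤x³ = begin
  n ^ 8          ≤⟨ ℕₚ.^-monoˡ-≤ 8 n≤x³ ⟩
  (x ^ 3) ^ 8    ≡⟨ ℕₚ.^-*-assoc x 3 8 ⟩
  x ^ 24         ≡⟨ ℕₚ.^-*-assoc x 8 3 ⟨
  (x ^ 8) ^ 3    ∎
  where open ℕₚ.≤-Reasoning

^-distribʳ-* : ∀ n a b → (a ℕ.* b) ^ n ≡ a ^ n ℕ.* b ^ n
^-distribʳ-* zero    a b = refl
^-distribʳ-* (suc n) a b = trans (cong (a ℕ.* b ℕ.*_) (^-distribʳ-* n a b))
  (ℕₚ.[m*n]*[o*p]≡[m*o]*[n*p] a b (a ^ n) (b ^ n))

-- The successor matches `recip`, whose denominator is one more than its argument.
*^8≤ : ∀ m l d → m ^ 8 ≤ 12 ℕ.* l → (d ℕ.* m) ^ 8 ≤ l ℕ.* suc (d ^ 8 ℕ.* 12)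
*^8≤ m l d m⁸≤ = begin
  (d ℕ.* m) ^ 8              ≡⟨ ^-distribʳ-* 8 d m ⟩
  d ^ 8 ℕ.* m ^ 8            ≤⟨ ℕₚ.*-monoʳ-≤ (d ^ 8) m⁸≤ ⟩
  d ^ 8 ℕ.* (12 ℕ.* l)       ≡⟨ ℕₚ.*-assoc (d ^ 8) 12 l ⟨
  d ^ 8 ℕ.* 12 ℕ.* l         ≡⟨ ℕₚ.*-comm (d ^ 8 ℕ.* 12) l ⟩
  l ℕ.* (d ^ 8 ℕ.* 12)       ≤⟨ ℕₚ.*-monoʳ-≤ l (ℕₚ.n≤1+n _) ⟩
  l ℕ.* suc (d ^ 8 ℕ.* 12)   ∎
  where open ℕₚ.≤-Reasoning

visible-cubes : ∀ d n m → 1 ≤ m → 27 ℕ.* m ^ 3 ≤ n → n ≤ (d ℕ.* m) ^ 3 →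
  ∃[ O ] ∃[ Qs ] Unique Qs × All (Visible {n} O) Qs ×
    (fromℚ (recip (d ^ 8 ℕ.* 12)) *ᵣ cbrt (n ^ 8) ≤ᵣ fromℕ (length Qs))
visible-cubes d n m 1≤m 27m³≤n n≤ =
  configuration , cubes , cubes-unique , all-visible ,
  recip-*ᵣ-cbrt-≤ (d ^ 8 ℕ.* 12) (n ^ 8) (length cubes) ((d ℕ.* m) ^ 8)
    (^8≤cube n (d ℕ.* m) n≤) (*^8≤ m (length cubes) d length-cubes)
  where open Construction m {{ℕ.>-nonZero 1≤m}} n 27m³≤n

theorem3p1 : ∃[ c ] (0ᵣ <ᵣ c) × (∃[ n₀ ] (∀ n → n₀ ≤ n →
    ∃[ O ] ∃[ Qs ] Unique Qs × All (Visible {n} O) Qs ×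
    (c *ᵣ cbrt (n ^ 8) ≤ᵣ fromℕ (length Qs))))
theorem3p1 =
  fromℚ c ,
  -- The sequence of `fromℚ c` is constant, so c itself serves as the distance from 0.
  (c , recip-pos (6 ^ 8 ℕ.* 12) , 0 , λ _ _ → ℚₚ.≤-reflexive (ℚₚ.+-identityˡ c)) ,
  27 , λ n 27≤n →
  let m , 1≤m , 27m³≤n , n≤ = cbrt-third n 27≤n in visible-cubes 6 n m 1≤m 27m³≤n n≤
  -- The 6 comes from n ≤ (6 m)³ and the 12 from the number of levels per cell.
  where c = recip (6 ^ 8 ℕ.* 12)
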